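{- Let $K$ be a field and let $G$ be a finite simple graph without isolated vertices and with $E_G\neq\emptyset$. Let $e\in E_G$ and let $\prec$ be a grevlex order on $K[E_G]$ with $t_e$ last. Let $$\vartheta\colon\mathcal{B}_\prec(I(X_G),t_e)\to\mathcal{E}(V_G)\times(\mathbb{Z}/2),\qquad \mathbf{t}^\alpha\mapsto(\theta(\mathbf{t}^\alpha),\deg(\mathbf{t}^\alpha)+2\mathbb{Z}).$$ Then $\vartheta$ is injective and $$\operatorname{Im}\vartheta=\{(T,i)\in\mathcal{E}(V_G)\times(\mathbb{Z}/2) : \mathcal{J}_i(G,T)\neq\emptyset\text{ and }\tau_{i+1}(G,T\triangle e)=\tau_i(G,T)+1\}.$$
   Context: $G$ has vertex set $V_G$ and edge set $E_G$, a non-empty set of $2$-element subsets of $V_G$. Put $K[V_G]=K[x_i : i\in V_G]$ and $K[E_G]=K[t_h : h\in E_G]$. Let $\varphi\colon K[E_G]\to K[V_G]$ be the $K$-algebra homomorphism with $\varphi(t_h)=x_ix_j$ for $h=\{i,j\}\in E_G$. The Eulerian ideal of $G$ is $I(X_G)=\varphi^{ -1}\big((x_i^2-x_j^2 : i,j\in V_G)\big)\subset K[E_G]$, and $(I(X_G),t_e)$ is the ideal generated by $I(X_G)$ and $t_e$. A grevlex order on $K[E_G]$ with $t_e$ last is the graded reverse lexicographic order induced by $t_{\epsilon(1)}\succ\cdots\succ t_{\epsilon(s)}$, where $s=|E_G|$ and $\epsilon\colon\{1,\dots,s\}\to E_G$ is a bijection with $\epsilon(s)=e$. For an ideal $I$,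 $\mathcal{B}_\prec(I)$ is the set of standard monomials of $I$, i.e. monomials not in the initial ideal $\operatorname{in}_\prec(I)$. For $\alpha\colon E_G\to\mathbb{N}$, write $\mathbf{t}^\alpha=\prod_{h\in E_G}t_h^{\alpha(h)}$ and $\mathcal{J}(\mathbf{t}^\alpha)=\{h\in E_G : \alpha(h)\text{ is odd}\}$; $\theta(\mathbf{t}^\alpha)$ is the set of odd degree vertices of the subgraph of $G$ edge-induced by $\mathcal{J}(\mathbf{t}^\alpha)$. $\mathcal{E}(V_G)$ is the set of even subsets of vertices: subsets $T\subset V_G$ such that $|T\cap V_H|$ is even for every connected component $H$ of $G$. A $T$-join is a subset $J\subset E_G$ such that $T$ is precisely the set of odd degree vertices of the subgraph edge-induced by $J$. For $T\in\mathcal{E}(V_G)$ and $i\in\mathbb{Z}/2$, $\mathcal{J}_i(G,T)$ is the set of $T$-joins $J$ with $|J|+2\mathbb{Z}=i$, and $\tau_i(G,T)$ is the minimum cardinality of an element of $\mathcal{J}_i(G,T)$, defined only when $\mathcal{J}_i(G,T)\neq\emptyset$. $\triangle$ denotes symmetric difference, and in $T\triangle e$ the edge $e=\{a,b\}$ is regarded as a $2$-element set of vertices (so $T\triangle e\in\mathcal{E}(V_G)$; moreover $\mathcal{J}_i(G,T)\neq\emptyset$ implies $\mathcal{J}_{i+1}(G,T\triangle e)\neq\emptyset$, so the condition makes sense). -}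

module Defs where

open import Algebra.Bundles using (CommutativeRing; RawRing)
import Algebra.Definitions.RawSemiring as RawSemiringDefinitions
open import Data.Bool.Base using (Bool; if_then_else_; _xor_)
open import Data.Fin.Base as Fin using (Fin)
open import Data.Fin.Permutation using (Permutation′; _⟨$⟩ʳ_)
open import Data.Fin.Subset using (Subset; _∩_; ∣_∣; ⁅_⁆)
  renaming (_∈_ to _∈ˢ_; _∪_ to _∪ˢ_)
open import Data.Fin.Subset.Properties using (_∈?_)
open import Data.List.Base as List using (List; []; _∷_; _++_)
open import Data.Nat.Base as ℕ using (ℕ; suc; parity)
import Data.Nat.Properties as ℕ
open import Data.Parity.Base as ℙ using (Parity; 0ℙ; 1ℙ)
import Data.Parity.Properties as ℙ
open import Data.Product.Base using (∃; ∃₂; _×_; _,_)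
open import Data.Sum.Base using (_⊎_)
open import Data.Vec.Base as Vec using (Vec; lookup; replicate; zipWith; tabulate; _[_]≔_)
open import Data.Vec.Properties using (≡-dec)
open import Function.Bundles using (_⇔_)
open import Level using (Level; 0ℓ; _⊔_) renaming (suc to lsuc)
open import Relation.Binary.Core using (Rel)
open import Relation.Binary.Construct.Closure.ReflexiveTransitive using (Star)
open import Relation.Binary.PropositionalEquality.Core using (_≡_)
open import Relation.Nullary.Decidable.Core using (does)
open import Relation.Nullary.Negation.Core using (¬_)
open import Relation.Unary using (Pred; _∈_; _∪_; ｛_｝)

record Field c ℓ : Set (lsuc (c ⊔ ℓ)) where
  field
    commutativeRing : CommutativeRing c ℓ
  open CommutativeRing commutativeRing public
  field
    1≉0     : ¬ (1# ≈ 0#)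
    inverse : ∀ x → ¬ (x ≈ 0#) → ∃ λ y → x * y ≈ 1#

------------------------------------------------------------------------
-- Polynomials

-- Exponent vectors.
Monomial : ℕ → Set
Monomial k = Vec ℕ k

deg : ∀ {k} → Monomial k → ℕ
deg = Vec.sum

module Polynomials {c ℓ : Level} (R : CommutativeRing c ℓ) where
  private module R = CommutativeRing R

  -- Formal sums of terms.  Monomials may be repeated and coefficients may
  -- vanish; polynomials are compared by their coefficients.
  Poly : ℕ → Set c
  Poly k = List (R.Carrier × Monomial k)

  coeff : ∀ {k} → Poly k → Monomial k → R.Carrier
  coeff []            m = R.0#
  coeff ((a , n) ∷ p) m =
    (if does (≡-dec ℕ._≟_ n m) then a else R.0#) R.+ coeff p m

  polyRing : ℕ → RawRing c ℓ
  polyRing k = record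
    { Carrier = Poly k
    ; _≈_     = λ p q → ∀ m → coeff p m R.≈ coeff q m
    ; _+_     = _++_
    ; _*_     = List.cartesianProductWith
                  (λ (a , m) (b , n) → (a R.* b , zipWith ℕ._+_ m n))
    ; -_      = List.map (λ (a , m) → (R.- a , m))
    ; 0#      = []
    ; 1#      = (R.1# , replicate k 0) ∷ []
    }

  constant : ∀ {k} → R.Carrier → Poly k
  constant {k} a = (a , replicate k 0) ∷ []

  monomial : ∀ {k} → Monomial k → Poly k
  monomial m = (R.1# , m) ∷ []

  var : ∀ {k} → Fin k → Poly k
  var {k} i = monomial (replicate k 0 [ i ]≔ 1)

  -- The R-algebra homomorphism that sends the i-th variable to f i.
  evalHom : ∀ {k l} → (Fin k → Poly l) → Poly k → Poly l
  evalHom {k} {l} f = List.foldr (λ (a , m) r → constant a * power m + r) 0#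
    where
    open RawRing (polyRing l)
    open RawSemiringDefinitions rawSemiring using (product; _^_)
    power : Monomial k → Poly l
    power m = product (λ i → f i ^ lookup m i)

  -- The ideal generated by S.
  data ⟨_⟩ {k : ℕ} {p : Level} (S : Pred (Poly k) p) : Pred (Poly k) (c ⊔ ℓ ⊔ p) where
    generator : ∀ {f} → f ∈ S → f ∈ ⟨ S ⟩
    zero      : RawRing.0# (polyRing k) ∈ ⟨ S ⟩
    sum       : ∀ {f g} → f ∈ ⟨ S ⟩ → g ∈ ⟨ S ⟩ →
                RawRing._+_ (polyRing k) f g ∈ ⟨ S ⟩
    multiple  : ∀ {f} q → f ∈ ⟨ S ⟩ → RawRing._*_ (polyRing k) q f ∈ ⟨ S ⟩
    respects  : ∀ {f g} → RawRing._≈_ (polyRing k) f g → f ∈ ⟨ S ⟩ → g ∈ ⟨ S ⟩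

  module _ {k : ℕ} (_≺_ : Rel (Monomial k) 0ℓ) where

    IsLeadingMonomial : Poly k → Monomial k → Set ℓ
    IsLeadingMonomial f m =
      ¬ (coeff f m R.≈ R.0#) × (∀ m′ → m ≺ m′ → coeff f m′ R.≈ R.0#)

    -- Generated by monic leading monomials, which over a field is the same
    -- as being generated by leading terms.
    initialIdeal : ∀ {p} → Pred (Poly k) p → Pred (Poly k) (c ⊔ ℓ ⊔ p)
    initialIdeal I =
      ⟨ (λ g → ∃₂ λ f m → f ∈ I × IsLeadingMonomial f m × g ≡ monomial m) ⟩

    StandardMonomial : ∀ {p} → Pred (Poly k) p → Pred (Monomial k) (c ⊔ ℓ ⊔ p)
    StandardMonomial I m = ¬ (monomial m ∈ initialIdeal I)

-- The graded reverse lexicographic order for which the variable of index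
-- ε(0) is the largest and that of index ε(k-1) the smallest.
Grevlex : ∀ {k} → Permutation′ k → Rel (Monomial k) 0ℓ
Grevlex ε α β =
  deg α ℕ.< deg β ⊎
  (deg α ≡ deg β ×
   ∃ λ i → lookup β (ε ⟨$⟩ʳ i) ℕ.< lookup α (ε ⟨$⟩ʳ i) ×
           (∀ j → i Fin.< j → lookup α (ε ⟨$⟩ʳ j) ≡ lookup β (ε ⟨$⟩ʳ j)))

------------------------------------------------------------------------
-- Graphs

infixl 6 _△_
_△_ : ∀ {n} → Subset n → Subset n → Subset n
_△_ = zipWith _xor_

isOdd : ℕ → Bool
isOdd n = does (parity n ℙ.≟ 1ℙ)

-- A finite simple graph with a non-empty edge set: the vertex set is Fin n,
-- and the 2-element subsets of Fin n that are edges are enumerated without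
-- repetition by Fin (suc m), each being listed as a pair i < j.
record Graph : Set where
  field
    n m    : ℕ
    left   : Fin (suc m) → Fin n
    right  : Fin (suc m) → Fin n
    ordered  : ∀ h → left h Fin.< right h
    distinct : ∀ {h h′} → left h ≡ left h′ → right h ≡ right h′ → h ≡ h′

  Vertex Edge : Set
  Vertex = Fin n
  Edge   = Fin (suc m)

  ends : Edge → Subset n
  ends h = ⁅ left h ⁆ ∪ˢ ⁅ right h ⁆

  NoIsolatedVertices : Set
  NoIsolatedVertices = ∀ (v : Vertex) → ∃ λ h → v ∈ˢ ends h

  Adjacent : Rel Vertex 0ℓ
  Adjacent u v = ∃ λ h → ends h ≡ ⁅ u ⁆ ∪ˢ ⁅ v ⁆

  IsComponent : Pred (Subset n) 0ℓ
  IsComponent C = ∃ λ u → ∀ v → v ∈ˢ C ⇔ Star Adjacent u v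

  EvenSubset : Pred (Subset n) 0ℓ
  EvenSubset T = ∀ C → IsComponent C → parity ∣ T ∩ C ∣ ≡ 0ℙ

  -- The degree of v in the subgraph edge-induced by J; it is 0 when v is
  -- not a vertex of that subgraph.
  degreeIn : Subset (suc m) → Vertex → ℕ
  degreeIn J v = ∣ J ∩ tabulate (λ h → does (v ∈? ends h)) ∣

  oddVertices : Subset (suc m) → Subset n
  oddVertices J = tabulate (λ v → isOdd (degreeIn J v))

  -- The set 𝒥ᵢ(G,T) of T-joins of parity i.
  Joins : Parity → Subset n → Pred (Subset (suc m)) 0ℓ
  Joins i T J = oddVertices J ≡ T × parity ∣ J ∣ ≡ i

  -- "τᵢ(G,T) is defined and equal to k".
  τ[_,_]≡_ : Parity → Subset n → ℕ → Set
  τ[ i , T ]≡ k =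
    (∃ λ J → J ∈ Joins i T × ∣ J ∣ ≡ k) × (∀ J → J ∈ Joins i T → k ℕ.≤ ∣ J ∣)

  oddPart : Monomial (suc m) → Subset (suc m)
  oddPart = Vec.map isOdd

  θ : Monomial (suc m) → Subset n
  θ α = oddVertices (oddPart α)

  ϑ : Monomial (suc m) → Subset n × Parity
  ϑ α = θ α , parity (deg α)

------------------------------------------------------------------------
-- The Eulerian ideal

module Eulerian {c ℓ : Level} (K : Field c ℓ) (G : Graph) where
  open Graph G
  open Polynomials (Field.commutativeRing K)

  φ : Poly (suc m) → Poly n
  φ = evalHom (λ h → var (left h) * var (right h))
    where open RawRing (polyRing n)

  squareDifferences : Pred (Poly n) c
  squareDifferences f =
    ∃₂ λ i j → f ≡ (var i * var i) + (- (var j * var j))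
    where open RawRing (polyRing n)

  eulerianIdeal : Pred (Poly (suc m)) (c ⊔ ℓ)
  eulerianIdeal f = φ f ∈ ⟨ squareDifferences ⟩

  eulerianIdealWith : Edge → Pred (Poly (suc m)) (c ⊔ ℓ)
  eulerianIdealWith e = ⟨ eulerianIdeal ∪ ｛ var e ｝ ⟩

  -- The set of standard monomials of (I(X_G), t_e) for the grevlex order
  -- defined by ε.
  𝓑 : Edge → Permutation′ (suc m) → Pred (Monomial (suc m)) (c ⊔ ℓ)
  𝓑 e ε = StandardMonomial (Grevlex ε) (eulerianIdealWith e)

{-# OPTIONS --safe #-}
-- Call two monomials of K[E_G] equivalent if they have the same degree and the
-- same θ.  The ideal I(X_G) is spanned by the differences of equivalent
-- monomials, so for every class the sum of the coefficients over that class is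
-- a functional vanishing on I(X_G), and it vanishes on (I(X_G), tₑ) if no
-- monomial of the class is divisible by tₑ.  Hence t^α is standard if and only
-- if its class avoids tₑ and t^α is the least monomial of the class.
--
-- The class of t^α avoids tₑ if and only if deg α = τᵢ(G,T) and
-- deg α + 1 = τᵢ₊₁(G,T △ e), where (T, i) = ϑ(t^α): a join violating one of the
-- two minima gives, after multiplication by a power of tₑ, a monomial of the
-- class divisible by tₑ, and conversely dividing such a monomial by tₑ gives
-- a T △ e-join of size less than deg α.
module Submission where

open import Defs
open import Algebra.Bundles using (CommutativeRing; RawRing)
import Algebra.Definitions.RawSemiring as RawSemiringDefinitions
import Algebra.Properties.Ring as RingProperties
open import Data.Bool.Base using (Bool; true; false; if_then_else_; _xor_; _∨_; _∧_)
import Data.Bool.Properties as Bool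
open import Data.Fin.Base as Fin using (Fin; zero; suc; fromℕ)
open import Data.Fin.Permutation using (Permutation′; _⟨$⟩ʳ_; _⟨$⟩ˡ_; inverseʳ)
import Data.Fin.Properties as Fin
open import Data.Fin.Subset using (Subset; _∩_; ∣_∣; ⁅_⁆; ⊥)
open import Data.Fin.Subset.Properties using (_∈?_; ∪-comm)
open import Data.List.Base as List using (List; []; _∷_; _++_)
open import Data.List.Membership.Propositional renaming (_∈_ to _∈ˡ_)
import Data.List.Membership.Propositional.Properties as List
open import Data.List.Relation.Unary.All as All using (All; []; _∷_)
open import Data.List.Relation.Unary.Any using (here; there)
open import Data.Nat.Base as ℕ using (ℕ; zero; suc; parity; z≤n; s≤s; ⌊_/2⌋)
import Data.Nat.Properties as ℕ
open import Data.Nat.Tactic.RingSolver using (solve-∀)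
open import Data.Parity.Base as ℙ using (Parity; 0ℙ; 1ℙ)
import Data.Parity.Properties as ℙ
open import Data.Product.Base using (∃; _×_; _,_; proj₁; proj₂)
open import Data.Sum.Base as Sum using (_⊎_; inj₁; inj₂)
open import Data.Vec.Base as Vec
  using (Vec; []; _∷_; lookup; replicate; tabulate; zipWith; _[_]≔_)
open import Data.Vec.Properties as Vec using (≡-dec)
open import Function.Base using (_∘_)
open import Function.Bundles using (_⇔_; mk⇔; Equivalence)
open import Level using (_⊔_)
open import Relation.Binary.Construct.Closure.ReflexiveTransitive as Star using (_◅_; _◅◅_)
open import Relation.Binary.Definitions using (Transitive; tri<; tri≈; tri>)
open import Relation.Binary.PropositionalEquality
  using (_≡_; _≢_; refl; sym; trans; cong; cong₂; subst; subst₂; module ≡-Reasoning)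
import Relation.Binary.Reasoning.Setoid as SetoidReasoning
open import Relation.Nullary.Decidable.Core using (Dec; does; yes; no; _×-dec_)
open import Relation.Nullary.Negation.Core using (¬_; contradiction)
open import Relation.Unary using (Pred; Decidable; _∈_; _∪_; ｛_｝)

-- Monomials

-- Degree and `θ` are the right invariants because `φ` sends t^α to a monomial of degree 2 deg α
-- whose set of odd exponents is `θ α`, and the residue class of a monomial modulo the differences
-- of squares depends on exactly these two data. So the functional of a class is built on K[V_G],
-- where the generators are explicit, and pulled back along `φ`. The obstacle is that equality in
-- `K` need not be decidable: a polynomial cannot be reduced to a normal form or searched for its
-- leading term. Membership in an ideal is therefore shown by explicit combinations and refuted by
-- functionals that vanish on the ideal. The same method serves the initial ideal, with the
-- coefficient at α as the functional.

infixl 6 _⊕_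
_⊕_ : ∀ {k} → Monomial k → Monomial k → Monomial k
_⊕_ = zipWith ℕ._+_

𝟘 : ∀ {k} → Monomial k
𝟘 = replicate _ 0

power : ∀ {k} → Fin k → ℕ → Monomial k
power i r = 𝟘 [ i ]≔ r

unit : ∀ {k} → Fin k → Monomial k
unit i = power i 1

⊕-assoc : ∀ {k} (α β γ : Monomial k) → α ⊕ β ⊕ γ ≡ α ⊕ (β ⊕ γ)
⊕-assoc = Vec.zipWith-assoc ℕ.+-assoc

⊕-comm : ∀ {k} (α β : Monomial k) → α ⊕ β ≡ β ⊕ α
⊕-comm = Vec.zipWith-comm ℕ.+-comm

⊕-identityˡ : ∀ {k} (α : Monomial k) → 𝟘 ⊕ α ≡ α
⊕-identityˡ = Vec.zipWith-identityˡ ℕ.+-identityˡ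

⊕-interchange : ∀ {k} (α β γ δ : Monomial k) → α ⊕ β ⊕ (γ ⊕ δ) ≡ α ⊕ γ ⊕ (β ⊕ δ)
⊕-interchange α β γ δ = begin
  α ⊕ β ⊕ (γ ⊕ δ)   ≡⟨ ⊕-assoc α β (γ ⊕ δ) ⟩
  α ⊕ (β ⊕ (γ ⊕ δ)) ≡⟨ cong (α ⊕_) (⊕-assoc β γ δ) ⟨
  α ⊕ (β ⊕ γ ⊕ δ)   ≡⟨ cong (λ x → α ⊕ (x ⊕ δ)) (⊕-comm β γ) ⟩
  α ⊕ (γ ⊕ β ⊕ δ)   ≡⟨ cong (α ⊕_) (⊕-assoc γ β δ) ⟩
  α ⊕ (γ ⊕ (β ⊕ δ)) ≡⟨ ⊕-assoc α γ (β ⊕ δ) ⟨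
  α ⊕ γ ⊕ (β ⊕ δ)   ∎
  where open ≡-Reasoning

⊕-cancelˡ : ∀ {k} (γ : Monomial k) {α β} → γ ⊕ α ≡ γ ⊕ β → α ≡ β
⊕-cancelˡ []      {[]}    {[]}    _  = refl
⊕-cancelˡ (c ∷ γ) {a ∷ α} {b ∷ β} eq = cong₂ _∷_
  (ℕ.+-cancelˡ-≡ c a b (cong Vec.head eq)) (⊕-cancelˡ γ (cong Vec.tail eq))

lookup-⊕ : ∀ {k} (i : Fin k) (α β : Monomial k) →
           lookup (α ⊕ β) i ≡ lookup α i ℕ.+ lookup β i
lookup-⊕ = Vec.lookup-zipWith ℕ._+_

lookup-injective : ∀ {A : Set} {k} {xs ys : Vec A k} → (∀ i → lookup xs i ≡ lookup ys i) → xs ≡ ys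
lookup-injective {xs = xs} {ys} eq = trans (sym (Vec.tabulate∘lookup xs))
  (trans (Vec.tabulate-cong eq) (Vec.tabulate∘lookup ys))

divide-power : ∀ {k} (i : Fin k) (α : Monomial k) {r} → lookup α i ≡ suc r →
               ∃ λ β → α ≡ unit i ⊕ β
divide-power zero    (.(suc r) ∷ α) {r} refl = r ∷ α , cong (suc r ∷_) (sym (⊕-identityˡ α))
divide-power (suc i) (a ∷ α) eq with β , α≡ ← divide-power i α eq =
  a ∷ β , cong (a ∷_) α≡

-- Weighted sums of exponents

bit : Bool → ℕ
bit b = if b then 1 else 0

-- The degree of a monomial is the case of the constant weight 1, the degree of a vertex the case of
-- its incidence bits; both inherit additivity from `dot-⊕`.
dot : ∀ {k} → Monomial k → (Fin k → ℕ) → ℕ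
dot []      g = 0
dot (a ∷ α) g = a ℕ.* g zero ℕ.+ dot α (g ∘ suc)

dot-cong : ∀ {k} (α : Monomial k) {f g} → (∀ i → f i ≡ g i) → dot α f ≡ dot α g
dot-cong []      f≗g = refl
dot-cong (a ∷ α) f≗g = cong₂ ℕ._+_ (cong (a ℕ.*_) (f≗g zero)) (dot-cong α (f≗g ∘ suc))

dot-𝟘 : ∀ {k} (g : Fin k → ℕ) → dot 𝟘 g ≡ 0
dot-𝟘 {zero}  g = refl
dot-𝟘 {suc k} g = dot-𝟘 (g ∘ suc)

dot-⊕ : ∀ {k} (α β : Monomial k) (g : Fin k → ℕ) →
        dot (α ⊕ β) g ≡ dot α g ℕ.+ dot β g
dot-⊕ []      []      g = refl
dot-⊕ (a ∷ α) (b ∷ β) g = trans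
  (cong ((a ℕ.+ b) ℕ.* g zero ℕ.+_) (dot-⊕ α β (g ∘ suc)))
  (interchange a b (g zero) (dot α (g ∘ suc)) (dot β (g ∘ suc)))
  where
  interchange : ∀ a b c x y →
    (a ℕ.+ b) ℕ.* c ℕ.+ (x ℕ.+ y) ≡ (a ℕ.* c ℕ.+ x) ℕ.+ (b ℕ.* c ℕ.+ y)
  interchange = solve-∀

dot-power : ∀ {k} (i : Fin k) r (g : Fin k → ℕ) → dot (power i r) g ≡ r ℕ.* g i
dot-power zero    r g = trans (cong (r ℕ.* g zero ℕ.+_) (dot-𝟘 (g ∘ suc))) (ℕ.+-identityʳ _)
dot-power (suc i) r g = dot-power i r (g ∘ suc)

dot-constant : ∀ {k} (α : Monomial k) c → dot α (λ _ → c) ≡ deg α ℕ.* c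
dot-constant []      c = refl
dot-constant (a ∷ α) c = trans (cong (a ℕ.* c ℕ.+_) (dot-constant α c))
                               (sym (ℕ.*-distribʳ-+ c a (deg α)))

deg≡dot : ∀ {k} (α : Monomial k) → deg α ≡ dot α (λ _ → 1)
deg≡dot α = sym (trans (dot-constant α 1) (ℕ.*-identityʳ (deg α)))

deg-⊕ : ∀ {k} (α β : Monomial k) → deg (α ⊕ β) ≡ deg α ℕ.+ deg β
deg-⊕ α β = trans (deg≡dot (α ⊕ β)) (trans (dot-⊕ α β _)
  (sym (cong₂ ℕ._+_ (deg≡dot α) (deg≡dot β))))

deg-power : ∀ {k} (i : Fin k) r → deg (power i r) ≡ r
deg-power i r = trans (deg≡dot (power i r)) (trans (dot-power i r _) (ℕ.*-identityʳ r))

-- Parities and odd parts of exponent vectors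

does-≟1ℙ-+ : ∀ p q → does (p ℙ.+ q ℙ.≟ 1ℙ) ≡ does (p ℙ.≟ 1ℙ) xor does (q ℙ.≟ 1ℙ)
does-≟1ℙ-+ 0ℙ q  = refl
does-≟1ℙ-+ 1ℙ 0ℙ = refl
does-≟1ℙ-+ 1ℙ 1ℙ = refl

isOdd-+ : ∀ a b → isOdd (a ℕ.+ b) ≡ isOdd a xor isOdd b
isOdd-+ a b = trans (cong (λ p → does (p ℙ.≟ 1ℙ)) (ℙ.+-homo-+ a b))
                    (does-≟1ℙ-+ (parity a) (parity b))

isOdd-bit : ∀ b → isOdd (bit b) ≡ b
isOdd-bit true  = refl
isOdd-bit false = refl

parity-cong-isOdd : ∀ {a b} → parity a ≡ parity b → isOdd a ≡ isOdd b
parity-cong-isOdd = cong (λ p → does (p ℙ.≟ 1ℙ))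

parity-bit-isOdd : ∀ a → parity (bit (isOdd a)) ≡ parity a
parity-bit-isOdd 0             = refl
parity-bit-isOdd 1             = refl
parity-bit-isOdd (suc (suc a)) = parity-bit-isOdd a

parity-double : ∀ a → parity (a ℕ.+ a) ≡ 0ℙ
parity-double a = trans (ℙ.+-homo-+ a a) (ℙ.p+p≡0ℙ (parity a))

parity-suc : ∀ a → parity (suc a) ≡ parity a ℙ.+ 1ℙ
parity-suc a = trans (ℙ.+-homo-+ 1 a) (ℙ.+-comm 1ℙ (parity a))

-- The gap has the form `r ℕ.+ r` because it is later filled by a square `γ ⊕ γ`, which leaves `θ`
-- unchanged.
parity≡⇒even-gap : ∀ {a b} → a ℕ.≤ b → parity a ≡ parity b → ∃ λ r → b ≡ a ℕ.+ (r ℕ.+ r)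
parity≡⇒even-gap {b = zero}            z≤n _  = 0 , refl
parity≡⇒even-gap {b = suc (suc b)}     z≤n eq with r , b≡ ← parity≡⇒even-gap {b = b} z≤n eq =
  suc r , cong suc (trans (cong suc b≡) (sym (ℕ.+-suc r r)))
parity≡⇒even-gap {suc a} {suc b} (s≤s a≤b) eq
  with r , b≡ ← parity≡⇒even-gap a≤b (ℙ.+-cancelʳ-≡ 1ℙ (parity a) (parity b)
                                  (trans (sym (parity-suc a)) (trans eq (parity-suc b)))) =
  r , cong suc b≡

∣∷∣ : ∀ {k} b (S : Subset k) → ∣ b ∷ S ∣ ≡ bit b ℕ.+ ∣ S ∣
∣∷∣ true  S = refl
∣∷∣ false S = refl

bit-∧ : ∀ a b → bit (a ∧ b) ≡ bit a ℕ.* bit b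
bit-∧ true  b = sym (ℕ.*-identityˡ (bit b))
bit-∧ false b = refl

-- An exponent and its odd bit differ by an even number. This replaces the cardinality in
-- `degreeIn`, which is not additive in α, by one that is.
parity-odd-∩ : ∀ {k} (α : Monomial k) (b : Fin k → Bool) →
               parity ∣ Vec.map isOdd α ∩ tabulate b ∣ ≡ parity (dot α (bit ∘ b))
parity-odd-∩ []      b = refl
parity-odd-∩ (a ∷ α) b = begin
  parity ∣ isOdd a ∧ b zero ∷ rest ∣
    ≡⟨ cong parity (∣∷∣ (isOdd a ∧ b zero) rest) ⟩
  parity (bit (isOdd a ∧ b zero) ℕ.+ ∣ rest ∣)
    ≡⟨ ℙ.+-homo-+ (bit (isOdd a ∧ b zero)) ∣ rest ∣ ⟩
  parity (bit (isOdd a ∧ b zero)) ℙ.+ parity ∣ rest ∣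
    ≡⟨ cong₂ ℙ._+_ head≡ (parity-odd-∩ α (b ∘ suc)) ⟩
  parity (a ℕ.* bit (b zero)) ℙ.+ parity (dot α (bit ∘ b ∘ suc))
    ≡⟨ ℙ.+-homo-+ (a ℕ.* bit (b zero)) _ ⟨
  parity (dot (a ∷ α) (bit ∘ b)) ∎
  where
  open ≡-Reasoning
  rest = Vec.map isOdd α ∩ tabulate (b ∘ suc)
  head≡ : parity (bit (isOdd a ∧ b zero)) ≡ parity (a ℕ.* bit (b zero))
  head≡ = begin
    parity (bit (isOdd a ∧ b zero))              ≡⟨ cong parity (bit-∧ (isOdd a) (b zero)) ⟩
    parity (bit (isOdd a) ℕ.* bit (b zero))      ≡⟨ ℙ.*-homo-* (bit (isOdd a)) _ ⟩
    parity (bit (isOdd a)) ℙ.* parity (bit (b zero))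
      ≡⟨ cong (ℙ._* parity (bit (b zero))) (parity-bit-isOdd a) ⟩
    parity a ℙ.* parity (bit (b zero)) ≡⟨ ℙ.*-homo-* a _ ⟨
    parity (a ℕ.* bit (b zero))                  ∎

parity-∣odd∣ : ∀ {k} (α : Monomial k) → parity ∣ Vec.map isOdd α ∣ ≡ parity (deg α)
parity-∣odd∣ []      = refl
parity-∣odd∣ (a ∷ α) = begin
  parity ∣ isOdd a ∷ odd ∣                ≡⟨ cong parity (∣∷∣ (isOdd a) odd) ⟩
  parity (bit (isOdd a) ℕ.+ ∣ odd ∣)      ≡⟨ ℙ.+-homo-+ (bit (isOdd a)) ∣ odd ∣ ⟩
  parity (bit (isOdd a)) ℙ.+ parity ∣ odd ∣ ≡⟨ cong₂ ℙ._+_ (parity-bit-isOdd a) (parity-∣odd∣ α) ⟩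
  parity a ℙ.+ parity (deg α)               ≡⟨ ℙ.+-homo-+ a (deg α) ⟨
  parity (deg (a ∷ α))                    ∎
  where
  open ≡-Reasoning
  odd = Vec.map isOdd α

bit-isOdd≤ : ∀ a → bit (isOdd a) ℕ.≤ a
bit-isOdd≤ 0             = z≤n
bit-isOdd≤ 1             = ℕ.≤-refl
bit-isOdd≤ (suc (suc a)) = ℕ.m≤n⇒m≤o+n 2 (bit-isOdd≤ a)

∣odd∣≤deg : ∀ {k} (α : Monomial k) → ∣ Vec.map isOdd α ∣ ℕ.≤ deg α
∣odd∣≤deg []      = z≤n
∣odd∣≤deg (a ∷ α) = subst (ℕ._≤ a ℕ.+ deg α) (sym (∣∷∣ (isOdd a) (Vec.map isOdd α)))
  (ℕ.+-mono-≤ (bit-isOdd≤ a) (∣odd∣≤deg α))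

-- A section of the odd part: it turns a join into a monomial of degree its size, so that degree
-- bounds become bounds on joins.
squarefree : ∀ {k} → Subset k → Monomial k
squarefree = Vec.map bit

odd-squarefree : ∀ {k} (J : Subset k) → Vec.map isOdd (squarefree J) ≡ J
odd-squarefree []      = refl
odd-squarefree (b ∷ J) = cong₂ _∷_ (isOdd-bit b) (odd-squarefree J)

deg-squarefree : ∀ {k} (J : Subset k) → deg (squarefree J) ≡ ∣ J ∣
deg-squarefree []      = refl
deg-squarefree (b ∷ J) = trans (cong (bit b ℕ.+_) (deg-squarefree J)) (sym (∣∷∣ b J))

zipWith-tabulate : ∀ {A B C : Set} {k} (h : A → B → C) (f : Fin k → A) (g : Fin k → B) →
                   zipWith h (tabulate f) (tabulate g) ≡ tabulate (λ i → h (f i) (g i))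
zipWith-tabulate {k = zero}  h f g = refl
zipWith-tabulate {k = suc k} h f g = cong (_ ∷_) (zipWith-tabulate h (f ∘ suc) (g ∘ suc))

does-∈? : ∀ {k} (x : Fin k) (S : Subset k) → does (x ∈? S) ≡ lookup S x
does-∈? zero    (true  ∷ S) = refl
does-∈? zero    (false ∷ S) = refl
does-∈? (suc x) (b ∷ S)     = does-∈? x S

lookup-unit : ∀ {k} (i x : Fin k) → lookup (unit i) x ≡ bit (lookup ⁅ i ⁆ x)
lookup-unit zero    zero    = refl
lookup-unit zero    (suc x) = trans (Vec.lookup-replicate x 0)
                                    (sym (cong bit (Vec.lookup-replicate x false)))
lookup-unit (suc i) zero    = refl
lookup-unit (suc i) (suc x) = lookup-unit i x

lookup-⁅⁆-disjoint : ∀ {k} {i j : Fin k} → i ≢ j → ∀ x → lookup ⁅ i ⁆ x ∧ lookup ⁅ j ⁆ x ≡ false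
lookup-⁅⁆-disjoint {i = zero}  {zero}  i≢j x       = contradiction refl i≢j
lookup-⁅⁆-disjoint {i = zero}  {suc j} i≢j zero    = refl
lookup-⁅⁆-disjoint {i = zero}  {suc j} i≢j (suc x) =
  cong (_∧ lookup ⁅ j ⁆ x) (Vec.lookup-replicate x false)
lookup-⁅⁆-disjoint {i = suc i} {zero}  i≢j zero    = refl
lookup-⁅⁆-disjoint {i = suc i} {zero}  i≢j (suc x) =
  trans (cong (lookup ⁅ i ⁆ x ∧_) (Vec.lookup-replicate x false)) (Bool.∧-zeroʳ _)
lookup-⁅⁆-disjoint {i = suc i} {suc j} i≢j zero    = refl
lookup-⁅⁆-disjoint {i = suc i} {suc j} i≢j (suc x) = lookup-⁅⁆-disjoint (i≢j ∘ cong suc) x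

bit-∨ : ∀ a b → a ∧ b ≡ false → bit (a ∨ b) ≡ bit a ℕ.+ bit b
bit-∨ true  false _ = refl
bit-∨ false b     _ = refl

-- Symmetric difference

△-assoc : ∀ {k} (S T U : Subset k) → S △ T △ U ≡ S △ (T △ U)
△-assoc = Vec.zipWith-assoc Bool.xor-assoc

△-comm : ∀ {k} (S T : Subset k) → S △ T ≡ T △ S
△-comm = Vec.zipWith-comm Bool.xor-comm

△-identityʳ : ∀ {k} (S : Subset k) → S △ ⊥ ≡ S
△-identityʳ = Vec.zipWith-identityʳ Bool.xor-identityʳ

△-same : ∀ {k} (S : Subset k) → S △ S ≡ ⊥
△-same []      = refl
△-same (b ∷ S) = cong₂ _∷_ (Bool.xor-same b) (△-same S)

△-cancelʳ : ∀ {k} (S T : Subset k) → S △ T △ T ≡ S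
△-cancelʳ S T = trans (△-assoc S T T) (trans (cong (S △_) (△-same T)) (△-identityʳ S))

-- T-joins

module TJoins (G : Graph) where
  open Graph G

  incident : Vertex → Edge → Bool
  incident x h = does (x ∈? ends h)

  θ≡tabulate : ∀ α → θ α ≡ tabulate (λ x → isOdd (dot α (bit ∘ incident x)))
  θ≡tabulate α = Vec.tabulate-cong λ x → parity-cong-isOdd
    {∣ oddPart α ∩ tabulate (incident x) ∣} {dot α (bit ∘ incident x)} (parity-odd-∩ α (incident x))

  θ-⊕ : ∀ α β → θ (α ⊕ β) ≡ θ α △ θ β
  θ-⊕ α β = begin
    θ (α ⊕ β)
      ≡⟨ θ≡tabulate (α ⊕ β) ⟩
    tabulate (λ x → isOdd (dot (α ⊕ β) (bit ∘ incident x)))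
      ≡⟨ Vec.tabulate-cong (λ x → trans (cong isOdd (dot-⊕ α β (bit ∘ incident x)))
                                        (isOdd-+ (dot α (bit ∘ incident x)) _)) ⟩
    tabulate (λ x → isOdd (dot α (bit ∘ incident x)) xor isOdd (dot β (bit ∘ incident x)))
      ≡⟨ zipWith-tabulate _xor_ _ _ ⟨
    tabulate (λ x → isOdd (dot α (bit ∘ incident x))) △
    tabulate (λ x → isOdd (dot β (bit ∘ incident x)))
      ≡⟨ cong₂ _△_ (θ≡tabulate α) (θ≡tabulate β) ⟨
    θ α △ θ β ∎
    where open ≡-Reasoning

  θ-unit : ∀ h → θ (unit h) ≡ ends h
  θ-unit h = begin
    θ (unit h)
      ≡⟨ θ≡tabulate (unit h) ⟩
    tabulate (λ x → isOdd (dot (unit h) (bit ∘ incident x)))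
      ≡⟨ Vec.tabulate-cong (λ x → trans (cong isOdd (trans (dot-power h 1 _) (ℕ.*-identityˡ _)))
                                (trans (isOdd-bit (incident x h)) (does-∈? x (ends h)))) ⟩
    tabulate (lookup (ends h))
      ≡⟨ Vec.tabulate∘lookup (ends h) ⟩
    ends h ∎
    where open ≡-Reasoning

  θ-squarefree : ∀ J → θ (squarefree J) ≡ oddVertices J
  θ-squarefree J = cong oddVertices (odd-squarefree J)

  θ-⊕-square : ∀ α β → θ (α ⊕ (β ⊕ β)) ≡ θ α
  θ-⊕-square α β = begin
    θ (α ⊕ (β ⊕ β))     ≡⟨ θ-⊕ α (β ⊕ β) ⟩
    θ α △ θ (β ⊕ β)     ≡⟨ cong (θ α △_) (trans (θ-⊕ β β) (△-same (θ β))) ⟩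
    θ α △ ⊥             ≡⟨ △-identityʳ (θ α) ⟩
    θ α                 ∎
    where open ≡-Reasoning

  infix 4 _∼_
  _∼_ : Monomial (suc m) → Monomial (suc m) → Set
  α ∼ β = deg α ≡ deg β × θ α ≡ θ β

  ∼-translate : ∀ γ {α β} → α ∼ β → γ ⊕ α ∼ γ ⊕ β
  ∼-translate γ {α} {β} (deg≡ , θ≡) =
    trans (deg-⊕ γ α) (trans (cong (deg γ ℕ.+_) deg≡) (sym (deg-⊕ γ β))) ,
    trans (θ-⊕ γ α) (trans (cong (θ γ △_) θ≡) (sym (θ-⊕ γ β)))

  Avoids : Edge → Monomial (suc m) → Set
  Avoids e α = ∀ β → β ∼ α → lookup β e ≡ 0

  -- Multiplication by a power of tₑ² changes neither θ nor the parity of the degree.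
  avoids⇒deg≤ : ∀ {e α} → Avoids e α → ∀ β → θ β ≡ θ α →
                parity (deg β) ≡ parity (deg α) → deg α ℕ.≤ deg β
  avoids⇒deg≤ {e} {α} avoids β θ≡ parity≡ with ℕ.≤-total (deg α) (deg β)
  ... | inj₁ α≤β = α≤β
  ... | inj₂ β≤α with parity≡⇒even-gap β≤α parity≡
  ...   | zero  , α≡ = ℕ.≤-reflexive (trans α≡ (ℕ.+-identityʳ (deg β)))
  ...   | suc r , α≡ = contradiction
    (trans (sym lookup≡) (avoids β′ (deg≡ , trans (θ-⊕-square β γ) θ≡))) λ ()
    where
    γ  = power e (suc r)
    β′ = β ⊕ (γ ⊕ γ)
    lookup≡ : lookup β′ e ≡ suc (r ℕ.+ (lookup β e ℕ.+ suc r))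
    lookup≡ = begin
      lookup β′ e                                  ≡⟨ lookup-⊕ e β (γ ⊕ γ) ⟩
      lookup β e ℕ.+ lookup (γ ⊕ γ) e              ≡⟨ cong (lookup β e ℕ.+_) (lookup-⊕ e γ γ) ⟩
      lookup β e ℕ.+ (lookup γ e ℕ.+ lookup γ e)   ≡⟨ cong (λ x → lookup β e ℕ.+ (x ℕ.+ x))
                                                           (Vec.lookup∘update e 𝟘 (suc r)) ⟩
      lookup β e ℕ.+ (suc r ℕ.+ suc r)             ≡⟨ shuffle (lookup β e) r ⟩
      suc (r ℕ.+ (lookup β e ℕ.+ suc r))           ∎
      where
      open ≡-Reasoning
      shuffle : ∀ x r → x ℕ.+ (suc r ℕ.+ suc r) ≡ suc (r ℕ.+ (x ℕ.+ suc r))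
      shuffle = solve-∀
    deg≡ : deg β′ ≡ deg α
    deg≡ = begin
      deg β′                                ≡⟨ trans (deg-⊕ β (γ ⊕ γ)) (cong (deg β ℕ.+_) (deg-⊕ γ γ)) ⟩
      deg β ℕ.+ (deg γ ℕ.+ deg γ)           ≡⟨ cong (λ x → deg β ℕ.+ (x ℕ.+ x)) (deg-power e (suc r)) ⟩
      deg β ℕ.+ (suc r ℕ.+ suc r)           ≡⟨ α≡ ⟨
      deg α                                 ∎
      where open ≡-Reasoning

  module _ {e : Edge} {α : Monomial (suc m)} (avoids : Avoids e α) where

    private
      i = parity (deg α)
      T = θ α

    -- The odd part of α is itself a T-join of parity i, so the lower bound applies to it and forces
    -- its size up to `deg α`. In particular a monomial whose class avoids tₑ is squarefree.
    avoids⇒τ : τ[ i , T ]≡ deg α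
    avoids⇒τ = (oddPart α , (refl , parity-∣odd∣ α) ,
                ℕ.≤-antisym (∣odd∣≤deg α) (bound (oddPart α) (refl , parity-∣odd∣ α))) , bound
      where
      bound : ∀ J → J ∈ Joins i T → deg α ℕ.≤ ∣ J ∣
      bound J (J-join , ∣J∣≡) = subst (deg α ℕ.≤_) (deg-squarefree J)
        (avoids⇒deg≤ {e} {α} avoids (squarefree J) (trans (θ-squarefree J) J-join)
          (trans (cong parity (deg-squarefree J)) ∣J∣≡))

    -- If J is a T △ e-join with |J| ≤ deg α, then |J| < deg α for parity
    -- reasons, and tₑ t^J times a power of tₑ² lies in the class of α.
    avoids⇒τ-△ : τ[ i ℙ.+ 1ℙ , T △ ends e ]≡ suc (deg α)
    avoids⇒τ-△ = (oddPart αₑ , joins , ℕ.≤-antisym ∣odd∣≤ (bound (oddPart αₑ) joins)) , bound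
      where
      αₑ = α ⊕ unit e
      deg-αₑ : deg αₑ ≡ suc (deg α)
      deg-αₑ = trans (deg-⊕ α (unit e)) (trans (cong (deg α ℕ.+_) (deg-power e 1)) (ℕ.+-comm (deg α) 1))
      ∣odd∣≤ : ∣ oddPart αₑ ∣ ℕ.≤ suc (deg α)
      ∣odd∣≤ = subst (∣ oddPart αₑ ∣ ℕ.≤_) deg-αₑ (∣odd∣≤deg αₑ)
      joins : oddPart αₑ ∈ Joins (i ℙ.+ 1ℙ) (T △ ends e)
      joins = trans (θ-⊕ α (unit e)) (cong (T △_) (θ-unit e)) ,
              trans (parity-∣odd∣ αₑ) (trans (cong parity deg-αₑ) (parity-suc (deg α)))
      bound : ∀ J → J ∈ Joins (i ℙ.+ 1ℙ) (T △ ends e) → suc (deg α) ℕ.≤ ∣ J ∣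
      bound J (J-join , ∣J∣≡) with ℕ.≤-total (suc (deg α)) ∣ J ∣
      ... | inj₁ α<J = α<J
      ... | inj₂ J≤α with parity≡⇒even-gap J≤α (trans ∣J∣≡ (sym (parity-suc (deg α))))
      ...   | zero  , α≡ = ℕ.≤-reflexive (trans α≡ (ℕ.+-identityʳ _))
      ...   | suc r , α≡ = contradiction (trans (sym lookup≡) (avoids β (deg≡ , θ≡))) λ ()
        where
        -- The gap from |J| to deg α + 1 is 2(r + 1). The factor tₑ in `β₀` accounts for one unit,
        -- and 2r more lead to degree |J| + 1 + 2r = deg α.
        γ = power e r
        β₀ = squarefree J ⊕ unit e
        β = β₀ ⊕ (γ ⊕ γ)
        lookup≡ : lookup β e ≡ suc (lookup (squarefree J) e ℕ.+ lookup (γ ⊕ γ) e)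
        lookup≡ = begin
          lookup β e
            ≡⟨ lookup-⊕ e β₀ (γ ⊕ γ) ⟩
          lookup β₀ e ℕ.+ lookup (γ ⊕ γ) e
            ≡⟨ cong (ℕ._+ lookup (γ ⊕ γ) e) (lookup-⊕ e (squarefree J) (unit e)) ⟩
          lookup (squarefree J) e ℕ.+ lookup (unit e) e ℕ.+ lookup (γ ⊕ γ) e
            ≡⟨ cong (λ x → lookup (squarefree J) e ℕ.+ x ℕ.+ lookup (γ ⊕ γ) e) (Vec.lookup∘update e 𝟘 1) ⟩
          lookup (squarefree J) e ℕ.+ 1 ℕ.+ lookup (γ ⊕ γ) e
            ≡⟨ cong (ℕ._+ lookup (γ ⊕ γ) e) (ℕ.+-comm _ 1) ⟩
          suc (lookup (squarefree J) e ℕ.+ lookup (γ ⊕ γ) e) ∎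
          where open ≡-Reasoning
        deg≡ : deg β ≡ deg α
        deg≡ = begin
          deg β
            ≡⟨ trans (deg-⊕ β₀ (γ ⊕ γ)) (cong₂ ℕ._+_ (deg-⊕ (squarefree J) (unit e)) (deg-⊕ γ γ)) ⟩
          deg (squarefree J) ℕ.+ deg (unit e) ℕ.+ (deg γ ℕ.+ deg γ)
            ≡⟨ cong₂ ℕ._+_ (cong₂ ℕ._+_ (deg-squarefree J) (deg-power e 1))
                           (cong (λ x → x ℕ.+ x) (deg-power e r)) ⟩
          ∣ J ∣ ℕ.+ 1 ℕ.+ (r ℕ.+ r)
            ≡⟨ ℕ.suc-injective (trans (shuffle ∣ J ∣ r) (sym α≡)) ⟩
          deg α ∎
          where
          open ≡-Reasoning
          shuffle : ∀ x r → suc (x ℕ.+ 1 ℕ.+ (r ℕ.+ r)) ≡ x ℕ.+ (suc r ℕ.+ suc r)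
          shuffle = solve-∀
        θ≡ : θ β ≡ θ α
        θ≡ = begin
          θ β                       ≡⟨ θ-⊕-square β₀ γ ⟩
          θ β₀                      ≡⟨ θ-⊕ (squarefree J) (unit e) ⟩
          θ (squarefree J) △ θ (unit e) ≡⟨ cong₂ _△_ (trans (θ-squarefree J) J-join) (θ-unit e) ⟩
          T △ ends e △ ends e       ≡⟨ △-cancelʳ T (ends e) ⟩
          T                         ∎
          where open ≡-Reasoning

  τ-△⇒avoids : ∀ {e α} → τ[ parity (deg α) ℙ.+ 1ℙ , θ α △ ends e ]≡ suc (deg α) → Avoids e α
  τ-△⇒avoids {e} {α} (_ , bound) β (deg≡ , θ≡) with lookup β e in lookup≡
  ... | zero  = refl
  ... | suc _ with β′ , refl ← divide-power e β lookup≡ =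
    contradiction (bound (oddPart β′) (join , parity≡)) (ℕ.<⇒≱ (s≤s small))
    where
    deg-β : suc (deg β′) ≡ deg α
    deg-β = trans (sym (trans (deg-⊕ (unit e) β′) (cong (ℕ._+ deg β′) (deg-power e 1)))) deg≡
    small : ∣ oddPart β′ ∣ ℕ.≤ deg α
    small = ℕ.≤-trans (∣odd∣≤deg β′) (ℕ.≤-trans (ℕ.n≤1+n _) (ℕ.≤-reflexive deg-β))
    parity≡ : parity ∣ oddPart β′ ∣ ≡ parity (deg α) ℙ.+ 1ℙ
    -- `parity` discards two successors by computation, so the explicit argument lets `deg β′` be
    -- read as `suc (suc (deg β′))`, that is `suc (deg α)`.
    parity≡ = trans (parity-∣odd∣ β′) (trans (cong parity {x = suc (suc (deg β′))} (cong suc deg-β))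
                                        (parity-suc (deg α)))
    join : θ β′ ≡ θ α △ ends e
    join = begin
      θ β′                     ≡⟨ △-cancelʳ (θ β′) (ends e) ⟨
      θ β′ △ ends e △ ends e   ≡⟨ cong (_△ ends e) (begin
        θ β′ △ ends e          ≡⟨ △-comm (θ β′) (ends e) ⟩
        ends e △ θ β′          ≡⟨ cong (_△ θ β′) (θ-unit e) ⟨
        θ (unit e) △ θ β′      ≡⟨ θ-⊕ (unit e) β′ ⟨
        θ (unit e ⊕ β′)        ≡⟨ θ≡ ⟩
        θ α                    ∎) ⟩
      θ α △ ends e             ∎
      where open ≡-Reasoning

-- The graded reverse lexicographic order

-- Searching the tail before comparing the heads finds the largest index of disagreement, the one at
-- which a reverse lexicographic comparison is decided.
lastDifference : ∀ {k} (f g : Fin k → ℕ) →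
  (∀ i → f i ≡ g i) ⊎ (∃ λ i → f i ≢ g i × (∀ j → i Fin.< j → f j ≡ g j))
lastDifference {zero}  f g = inj₁ λ ()
lastDifference {suc k} f g with lastDifference (f ∘ suc) (g ∘ suc)
... | inj₂ (i , fᵢ≢gᵢ , eq) = inj₂ (suc i , fᵢ≢gᵢ , λ { (suc j) (s≤s i<j) → eq j i<j })
... | inj₁ eq with f zero ℕ.≟ g zero
...   | yes f₀≡g₀ = inj₁ λ { zero → f₀≡g₀ ; (suc i) → eq i }
...   | no  f₀≢g₀ = inj₂ (zero , f₀≢g₀ , λ { (suc j) _ → eq j })

-- A box, with every exponent at most d, instead of the simplex of degree at most d: any finite list
-- containing the simplex serves the search for a minimum.
boundedMonomials : ∀ k → ℕ → List (Monomial k)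
boundedMonomials zero    d = [] ∷ []
boundedMonomials (suc k) d =
  List.cartesianProductWith _∷_ (List.upTo (suc d)) (boundedMonomials k d)

∈-boundedMonomials : ∀ {k d} (α : Monomial k) → deg α ℕ.≤ d → α ∈ˡ boundedMonomials k d
∈-boundedMonomials []      _   = here refl
∈-boundedMonomials (a ∷ α) α≤d = List.∈-cartesianProductWith⁺ _∷_
  (List.∈-upTo⁺ (s≤s (ℕ.m+n≤o⇒m≤o a α≤d))) (∈-boundedMonomials α (ℕ.m+n≤o⇒n≤o a α≤d))

module GrevlexProperties {k} (ε : Permutation′ k) where

  infix 4 _≺_
  _≺_ = Grevlex ε

  ≺-irrefl : ∀ {α} → ¬ (α ≺ α)
  ≺-irrefl (inj₁ α<α)               = ℕ.<-irrefl refl α<α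
  ≺-irrefl (inj₂ (_ , _ , αᵢ<αᵢ , _)) = ℕ.<-irrefl refl αᵢ<αᵢ

  ≺-trans : Transitive _≺_
  ≺-trans (inj₁ α<β)       (inj₁ β<γ)       = inj₁ (ℕ.<-trans α<β β<γ)
  ≺-trans (inj₁ α<β)       (inj₂ (β≡γ , _)) = inj₁ (subst (_ ℕ.<_) β≡γ α<β)
  ≺-trans (inj₂ (α≡β , _)) (inj₁ β<γ)       = inj₁ (subst (ℕ._< _) (sym α≡β) β<γ)
  ≺-trans (inj₂ (α≡β , i , βᵢ<αᵢ , eqᵢ)) (inj₂ (β≡γ , j , γⱼ<βⱼ , eqⱼ)) =
    inj₂ (trans α≡β β≡γ , lex)
    where
    lex : ∃ λ l → _
    -- The later of the two deciding indices decides the composite comparison.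
    lex with Fin.<-cmp i j
    ... | tri< i<j _ _ = j , subst (_ ℕ.<_) (sym (eqᵢ j i<j)) γⱼ<βⱼ ,
                         λ l j<l → trans (eqᵢ l (Fin.<-trans i<j j<l)) (eqⱼ l j<l)
    ... | tri≈ _ refl _ = i , ℕ.<-trans γⱼ<βⱼ βᵢ<αᵢ , λ l i<l → trans (eqᵢ l i<l) (eqⱼ l i<l)
    ... | tri> _ _ j<i = i , subst (ℕ._< _) (eqⱼ i j<i) βᵢ<αᵢ ,
                         λ l i<l → trans (eqᵢ l i<l) (eqⱼ l (Fin.<-trans j<i i<l))

  ≺-total : ∀ α β → α ≺ β ⊎ α ≡ β ⊎ β ≺ α
  ≺-total α β with ℕ.<-cmp (deg α) (deg β)
  ... | tri< α<β _ _ = inj₁ (inj₁ α<β)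
  ... | tri> _ _ β<α = inj₂ (inj₂ (inj₁ β<α))
  ... | tri≈ _ deg≡ _ with lastDifference (lookup α ∘ (ε ⟨$⟩ʳ_)) (lookup β ∘ (ε ⟨$⟩ʳ_))
  ...   | inj₁ eq = inj₂ (inj₁ (lookup-injective λ i →
      subst (λ j → lookup α j ≡ lookup β j) (inverseʳ ε) (eq (ε ⟨$⟩ˡ i))))
  ...   | inj₂ (i , αᵢ≢βᵢ , eq) with ℕ.<-cmp (lookup α (ε ⟨$⟩ʳ i)) (lookup β (ε ⟨$⟩ʳ i))
  ...     | tri< αᵢ<βᵢ _ _ = inj₂ (inj₂ (inj₂ (sym deg≡ , i , αᵢ<βᵢ , λ j i<j → sym (eq j i<j))))
  ...     | tri≈ _ αᵢ≡βᵢ _ = contradiction αᵢ≡βᵢ αᵢ≢βᵢ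
  ...     | tri> _ _ βᵢ<αᵢ = inj₁ (inj₂ (deg≡ , i , βᵢ<αᵢ , eq))

  -- This direction of compatibility with multiplication passes leastness from a monomial to its
  -- divisors.
  ≺-cancelˡ : ∀ γ {α β} → γ ⊕ α ≺ γ ⊕ β → α ≺ β
  ≺-cancelˡ γ {α} {β} (inj₁ lt) =
    inj₁ (ℕ.+-cancelˡ-< (deg γ) _ _ (subst₂ ℕ._<_ (deg-⊕ γ α) (deg-⊕ γ β) lt))
  ≺-cancelˡ γ {α} {β} (inj₂ (deg≡ , i , lt , eq)) =
    inj₂ (ℕ.+-cancelˡ-≡ (deg γ) _ _ (trans (sym (deg-⊕ γ α)) (trans deg≡ (deg-⊕ γ β))) , i ,
          ℕ.+-cancelˡ-< (lookup γ _) _ _ (subst₂ ℕ._<_ (lookup-⊕ _ γ β) (lookup-⊕ _ γ α) lt) ,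
          λ j i<j → ℕ.+-cancelˡ-≡ (lookup γ _) _ _
            (trans (sym (lookup-⊕ _ γ α)) (trans (eq j i<j) (lookup-⊕ _ γ β))))

  infix 4 _≼_
  _≼_ : Monomial k → Monomial k → Set
  α ≼ β = α ≡ β ⊎ α ≺ β

  least-in-list : ∀ α αs → ∃ λ β → β ∈ˡ α ∷ αs × All (β ≼_) (α ∷ αs)
  least-in-list α []        = α , here refl , inj₁ refl ∷ []
  least-in-list α (α′ ∷ αs) with β , β∈ , β≼ ← least-in-list α′ αs | ≺-total α β
  ... | inj₁ α≺β = α , here refl , inj₁ refl ∷ All.map below β≼
    where
    below : ∀ {γ} → β ≼ γ → α ≼ γ
    below     (inj₁ refl) = inj₂ α≺β
    below {γ} (inj₂ β≺γ)  = inj₂ (≺-trans {α} {β} {γ} α≺β β≺γ)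
  ... | inj₂ β≼α = β , there β∈ , Sum.map₁ sym β≼α ∷ β≼

  -- The degree bound confines `P` to a finite list, so pairwise comparison takes the place of
  -- well-founded descent along `≺`.
  least : ∀ {p} {P : Pred (Monomial k) p} → Decidable P → ∀ d → (∀ {α} → P α → deg α ℕ.≤ d) →
          ∃ P → ∃ λ β → P β × (∀ γ → P γ → β ≼ γ)
  least {P = P} P? d bounded (α , Pα) =
    minimum (List.filter P? (boundedMonomials k d)) list-complete list-sound
    where
    list-complete : ∀ γ → P γ → γ ∈ˡ List.filter P? (boundedMonomials k d)
    list-complete γ Pγ = List.∈-filter⁺ P? (∈-boundedMonomials γ (bounded Pγ)) Pγ
    list-sound : ∀ {γ} → γ ∈ˡ List.filter P? (boundedMonomials k d) → P γ
    list-sound γ∈ = proj₂ (List.∈-filter⁻ P? {xs = boundedMonomials k d} γ∈)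
    minimum : ∀ αs → (∀ γ → P γ → γ ∈ˡ αs) → (∀ {γ} → γ ∈ˡ αs → P γ) →
              ∃ λ β → P β × (∀ γ → P γ → β ≼ γ)
    minimum []       complete _     = contradiction (complete α Pα) λ ()
    minimum (γ ∷ γs) complete sound with β , β∈ , β≼ ← least-in-list γ γs =
      β , sound β∈ , λ δ Pδ → All.lookup β≼ (complete δ Pδ)

-- Linear functionals on polynomials

infixr 7 _•_
-- The recursion has the shape of `_^_` on polynomials, which `term-^` follows case by case.
_•_ : ∀ {k} → ℕ → Monomial k → Monomial k
zero  • u = 𝟘
suc a • u = u ⊕ (a • u)

-- The exponent vector of the image of t^α under tᵢ ↦ x^(u i).
combine : ∀ {k l} → (Fin k → Monomial l) → Monomial k → Monomial l
combine u []      = 𝟘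
combine u (a ∷ α) = (a • u zero) ⊕ combine (u ∘ suc) α

module _ {l} (F : Monomial l → ℕ) (F-𝟘 : F 𝟘 ≡ 0)
         (F-⊕ : ∀ u v → F (u ⊕ v) ≡ F u ℕ.+ F v) where

  additive-• : ∀ a u → F (a • u) ≡ a ℕ.* F u
  additive-• zero    u = F-𝟘
  additive-• (suc a) u = trans (F-⊕ u (a • u)) (cong (F u ℕ.+_) (additive-• a u))

  -- Stated for every additive `F` because both coordinates and the linear forms `dot` are needed.
  additive-combine : ∀ {k} (u : Fin k → Monomial l) α → F (combine u α) ≡ dot α (F ∘ u)
  additive-combine u []      = F-𝟘
  additive-combine u (a ∷ α) = trans (F-⊕ (a • u zero) _)
    (cong₂ ℕ._+_ (additive-• a (u zero)) (additive-combine (u ∘ suc) α))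

lookup-combine : ∀ {k l} (u : Fin k → Monomial l) α x →
                 lookup (combine u α) x ≡ dot α (λ i → lookup (u i) x)
lookup-combine u α x = additive-combine (λ v → lookup v x)
  (Vec.lookup-replicate x 0) (lookup-⊕ x) u α

combine-⊕ : ∀ {k l} (u : Fin k → Monomial l) α β →
            combine u (α ⊕ β) ≡ combine u α ⊕ combine u β
combine-⊕ u α β = lookup-injective λ x → begin
  lookup (combine u (α ⊕ β)) x
    ≡⟨ lookup-combine u (α ⊕ β) x ⟩
  dot (α ⊕ β) (λ i → lookup (u i) x)
    ≡⟨ dot-⊕ α β _ ⟩
  dot α (λ i → lookup (u i) x) ℕ.+ dot β (λ i → lookup (u i) x)
    ≡⟨ cong₂ ℕ._+_ (lookup-combine u α x) (lookup-combine u β x) ⟨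
  lookup (combine u α) x ℕ.+ lookup (combine u β) x
    ≡⟨ lookup-⊕ x (combine u α) (combine u β) ⟨
  lookup (combine u α ⊕ combine u β) x ∎
  where open ≡-Reasoning

module Functionals {c ℓ} (R : CommutativeRing c ℓ) where
  open CommutativeRing R hiding (zero; _≉_)
    renaming (refl to ≈-refl; sym to ≈-sym; trans to ≈-trans)
  open RingProperties ring using (-0#≈0#; -‿distribˡ-*; -‿+-comm)
  open Polynomials R public
  open SetoidReasoning setoid

  private
    module P {k : ℕ} where
      open RawRing (polyRing k) public
      open RawSemiringDefinitions rawSemiring public using (product; _^_)

    variable
      k l : ℕ

  Weight : ℕ → Set c
  Weight k = Monomial k → Carrier

  -- A linear functional, given by its values on monomials. It is defined on formal sums; that it
  -- depends only on the coefficients is `apply-≈`.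
  apply : Weight k → Poly k → Carrier
  apply w []            = 0#
  apply w ((a , m) ∷ p) = a * w m + apply w p

  -- The adjoint of multiplication by the monomial with exponent μ.
  translate : Monomial k → Weight k → Weight k
  translate μ w = w ∘ (μ ⊕_)

  apply-cong : ∀ {v w : Weight k} → (∀ m → v m ≈ w m) → ∀ p → apply v p ≈ apply w p
  apply-cong v≈w []            = ≈-refl
  apply-cong v≈w ((a , m) ∷ p) = +-cong (*-congˡ (v≈w m)) (apply-cong v≈w p)

  apply-++ : ∀ (w : Weight k) p q → apply w (p ++ q) ≈ apply w p + apply w q
  apply-++ w []            q = ≈-sym (+-identityˡ _)
  apply-++ w ((a , m) ∷ p) q = ≈-trans (+-congˡ (apply-++ w p q)) (≈-sym (+-assoc _ _ _))

  apply-neg : ∀ (w : Weight k) p → apply w (P.- p) ≈ - apply w p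
  apply-neg w []            = ≈-sym -0#≈0#
  apply-neg w ((a , m) ∷ p) = ≈-trans (+-cong (≈-sym (-‿distribˡ-* a (w m))) (apply-neg w p))
                                    (-‿+-comm _ _)

  apply-* : ∀ (w : Weight k) p q →
            apply w (p P.* q) ≈ apply (λ μ → apply (translate μ w) q) p
  apply-* w []            q = ≈-refl
  apply-* w ((a , μ) ∷ p) q = ≈-trans (apply-++ w (List.map _ q) (p P.* q))
                                    (+-cong (term q) (apply-* w p q))
    where
    term : ∀ q → apply w (List.map (λ (b , n) → (a * b , μ ⊕ n)) q) ≈ a * apply (translate μ w) q
    term []            = ≈-sym (zeroʳ a)
    term ((b , n) ∷ q) = ≈-trans (+-cong (*-assoc a b _) (term q)) (≈-sym (distribˡ a _ _))

  apply-0 : ∀ (p : Poly k) → apply (λ _ → 0#) p ≈ 0#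
  apply-0 []            = ≈-refl
  apply-0 ((a , m) ∷ p) = ≈-trans (+-cong (zeroʳ a) (apply-0 p)) (+-identityˡ 0#)

  indicator : ∀ {a} {A : Set a} → Dec A → Carrier
  indicator A? = if does A? then 1# else 0#

  indicator-yes : ∀ {a} {A : Set a} (A? : Dec A) → A → indicator A? ≈ 1#
  indicator-yes (yes _) _ = ≈-refl
  indicator-yes (no ¬a) a = contradiction a ¬a

  indicator-no : ∀ {a} {A : Set a} (A? : Dec A) → ¬ A → indicator A? ≈ 0#
  indicator-no (yes a) ¬a = contradiction a ¬a
  indicator-no (no _)  _  = ≈-refl

  point : Monomial k → Weight k
  point m n = indicator (≡-dec ℕ._≟_ n m)

  coeff≈apply : ∀ (p : Poly k) m → coeff p m ≈ apply (point m) p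
  coeff≈apply []            m = ≈-refl
  coeff≈apply ((a , n) ∷ p) m = +-cong term (coeff≈apply p m)
    where
    term : (if does (≡-dec ℕ._≟_ n m) then a else 0#) ≈ a * point m n
    term with does (≡-dec ℕ._≟_ n m)
    ... | true  = ≈-sym (*-identityʳ a)
    ... | false = ≈-sym (zeroʳ a)

  erase : Monomial k → Weight k → Weight k
  erase s w m = if does (≡-dec ℕ._≟_ m s) then 0# else w m

  -- As functionals, `w` is `erase s w` plus `w s` times the coefficient at s. All repetitions of s
  -- in the list are collected by `coeff` at once.
  apply-erase : ∀ s (w : Weight k) p → apply w p ≈ apply (erase s w) p + w s * coeff p s
  apply-erase s w []            = ≈-sym (≈-trans (+-identityˡ _) (zeroʳ (w s)))
  apply-erase s w ((a , m) ∷ p) = begin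
    a * w m + apply w p
      ≈⟨ +-cong term (apply-erase s w p) ⟩
    (a * erase s w m + w s * here?) + (apply (erase s w) p + w s * coeff p s)
      ≈⟨ interchange _ _ _ _ ⟩
    (a * erase s w m + apply (erase s w) p) + (w s * here? + w s * coeff p s)
      ≈⟨ +-congˡ (distribˡ (w s) _ _) ⟨
    (a * erase s w m + apply (erase s w) p) + w s * (here? + coeff p s) ∎
    where
    open import Algebra.Properties.CommutativeSemigroup +-commutativeSemigroup using (interchange)
    here? = if does (≡-dec ℕ._≟_ m s) then a else 0#
    term : a * w m ≈ a * erase s w m + w s * here?
    term with ≡-dec ℕ._≟_ m s
    ... | yes refl = ≈-trans (*-comm a (w s)) (≈-sym (≈-trans (+-congʳ (zeroʳ a)) (+-identityˡ _)))
    ... | no  _    = ≈-sym (≈-trans (+-congˡ (zeroʳ (w s))) (+-identityʳ _))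

  -- Repeated terms make the induction over p fail; instead the monomials of p
  -- are erased from the support of w one after the other.
  apply-vanishes : ∀ (w : Weight k) p → (∀ m → w m * coeff p m ≈ 0#) → apply w p ≈ 0#
  apply-vanishes {k} w₀ p = go (List.map proj₂ p) w₀
    (All.tabulate λ t∈p → inj₁ (List.∈-map⁺ proj₂ t∈p))
    where
    -- Invariant: the monomial of each term of `p` is still waiting in `S` or already has weight 0.
    go : ∀ (S : List (Monomial k)) w → All (λ t → proj₂ t ∈ˡ S ⊎ w (proj₂ t) ≈ 0#) p →
         (∀ m → w m * coeff p m ≈ 0#) → apply w p ≈ 0#
    go [] w supported _ = none p supported
      where
      none : ∀ q → All (λ t → proj₂ t ∈ˡ [] ⊎ w (proj₂ t) ≈ 0#) q → apply w q ≈ 0#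
      none []            []                = ≈-refl
      none ((a , m) ∷ q) (inj₂ w≈0 ∷ rest) =
        ≈-trans (+-cong (≈-trans (*-congˡ w≈0) (zeroʳ a)) (none q rest)) (+-identityˡ 0#)
    go (s ∷ S) w supported vanish = begin
      apply w p                              ≈⟨ apply-erase s w p ⟩
      apply (erase s w) p + w s * coeff p s
        ≈⟨ +-cong (go S (erase s w) (All.map (λ {t} → shrink t) supported) vanish′) (vanish s) ⟩
      0# + 0#                                ≈⟨ +-identityˡ 0# ⟩
      0#                                     ∎
      where
      shrink : ∀ (t : Carrier × Monomial k) → proj₂ t ∈ˡ s ∷ S ⊎ w (proj₂ t) ≈ 0# →
               proj₂ t ∈ˡ S ⊎ erase s w (proj₂ t) ≈ 0#
      shrink (_ , m) member with ≡-dec ℕ._≟_ m s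
      shrink (_ , m) _                   | yes _   = inj₂ ≈-refl
      shrink (_ , m) (inj₁ (here m≡s))   | no m≢s  = contradiction m≡s m≢s
      shrink (_ , m) (inj₁ (there m∈S))  | no _    = inj₁ m∈S
      shrink (_ , m) (inj₂ w≈0)          | no _    = inj₂ w≈0
      vanish′ : ∀ m → erase s w m * coeff p m ≈ 0#
      vanish′ m with ≡-dec ℕ._≟_ m s
      ... | yes _ = zeroˡ _
      ... | no  _ = vanish m

  coeff-++ : ∀ (p q : Poly k) m → coeff (p ++ q) m ≈ coeff p m + coeff q m
  coeff-++ p q m = ≈-trans (coeff≈apply (p ++ q) m) (≈-trans (apply-++ (point m) p q)
    (≈-sym (+-cong (coeff≈apply p m) (coeff≈apply q m))))

  coeff-neg : ∀ (p : Poly k) m → coeff (P.- p) m ≈ - coeff p m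
  coeff-neg p m = ≈-trans (coeff≈apply (P.- p) m) (≈-trans (apply-neg (point m) p)
    (≈-sym (-‿cong (coeff≈apply p m))))

  -- All coefficients of the formal sum p - q vanish, so `apply-vanishes` applies to it with any
  -- weight.
  apply-≈ : ∀ (w : Weight k) p q → p P.≈ q → apply w p ≈ apply w q
  apply-≈ w p q p≈q = x∙y⁻¹≈ε⇒x≈y _ _ (begin
    apply w p - apply w q        ≈⟨ +-congˡ (apply-neg w q) ⟨
    apply w p + apply w (P.- q)  ≈⟨ apply-++ w p (P.- q) ⟨
    apply w (p ++ (P.- q))       ≈⟨ apply-vanishes w (p ++ (P.- q)) (λ m →
                                      ≈-trans (*-congˡ (zero-coeff m)) (zeroʳ _)) ⟩
    0#                           ∎)
    where
    open RingProperties ring using (x∙y⁻¹≈ε⇒x≈y)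
    zero-coeff : ∀ m → coeff (p ++ (P.- q)) m ≈ 0#
    zero-coeff m = ≈-trans (coeff-++ p (P.- q) m)
      (≈-trans (+-cong (p≈q m) (coeff-neg q m)) (-‿inverseʳ (coeff q m)))

  -- Coefficients are functionals, so functionals separate polynomials. Polynomial identities are
  -- checked in this way below, by computing in the ring instead of rearranging lists.
  apply⇒≈ : ∀ (p q : Poly k) → (∀ w → apply w p ≈ apply w q) → p P.≈ q
  apply⇒≈ p q eq m = ≈-trans (coeff≈apply p m) (≈-trans (eq (point m)) (≈-sym (coeff≈apply q m)))

  -- The vanishing of one functional does not survive multiplication by q, but that of all its
  -- translates does: the value at q f is a combination of values of translates at f.
  apply-translate-⟨⟩ : ∀ {s} {S : Pred (Poly k) s} (w : Weight k) →
    (∀ μ {g} → g ∈ S → apply (translate μ w) g ≈ 0#) →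
    ∀ {f} → f ∈ ⟨ S ⟩ → ∀ μ → apply (translate μ w) f ≈ 0#
  apply-translate-⟨⟩ w kills (generator g∈S)   μ = kills μ g∈S
  apply-translate-⟨⟩ w kills zero              μ = ≈-refl
  apply-translate-⟨⟩ w kills (sum {f} {g} f∈ g∈) μ = ≈-trans (apply-++ (translate μ w) f g)
    (≈-trans (+-cong (apply-translate-⟨⟩ w kills f∈ μ) (apply-translate-⟨⟩ w kills g∈ μ)) (+-identityˡ 0#))
  apply-translate-⟨⟩ w kills (multiple {f} q f∈) μ = begin
    apply (translate μ w) (q P.* f)
      ≈⟨ apply-* (translate μ w) q f ⟩
    apply (λ ν → apply (translate ν (translate μ w)) f) q
      ≈⟨ apply-cong (λ ν → ≈-trans (apply-cong (λ m → reflexive (cong w (sym (⊕-assoc μ ν m)))) f)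
                                 (apply-translate-⟨⟩ w kills f∈ (μ ⊕ ν))) q ⟩
    apply (λ _ → 0#) q
      ≈⟨ apply-0 q ⟩
    0# ∎
  apply-translate-⟨⟩ w kills (respects {f} {g} f≈g f∈) μ =
    ≈-trans (≈-sym (apply-≈ (translate μ w) f g f≈g)) (apply-translate-⟨⟩ w kills f∈ μ)

  apply-⟨⟩ : ∀ {s} {S : Pred (Poly k) s} (w : Weight k) →
    (∀ μ {g} → g ∈ S → apply (translate μ w) g ≈ 0#) →
    ∀ {f} → f ∈ ⟨ S ⟩ → apply w f ≈ 0#
  apply-⟨⟩ w kills {f} f∈ = ≈-trans
    (apply-cong (λ m → reflexive (cong w (sym (⊕-identityˡ m)))) f)
    (apply-translate-⟨⟩ w kills f∈ 𝟘)

  -- The coefficient is only `≈ 1#` because products of monomials carry coefficients such as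
  -- `1# * 1#`.
  IsTerm : Poly k → Monomial k → Set (c ⊔ ℓ)
  IsTerm p u = ∃ λ a → p ≡ (a , u) ∷ [] × a ≈ 1#

  term-monomial : ∀ (u : Monomial k) → IsTerm (monomial u) u
  term-monomial u = 1# , refl , ≈-refl

  term-* : ∀ {p q : Poly k} {u v} → IsTerm p u → IsTerm q v → IsTerm (p P.* q) (u ⊕ v)
  term-* (a , refl , a≈1) (b , refl , b≈1) =
    a * b , refl , ≈-trans (*-cong a≈1 b≈1) (*-identityˡ 1#)

  term-^ : ∀ {p : Poly k} {u} a → IsTerm p u → IsTerm (p P.^ a) (a • u)
  term-^ zero    _    = term-monomial 𝟘
  term-^ (suc a) term = term-* term (term-^ a term)

  term-product : ∀ {f : Fin k → Poly l} {u} → (∀ i → IsTerm (f i) (u i)) →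
                 ∀ α → IsTerm (P.product (λ i → f i P.^ lookup α i)) (combine u α)
  term-product terms []      = term-monomial 𝟘
  term-product terms (a ∷ α) = term-* (term-^ a (terms zero)) (term-product (terms ∘ suc) α)

  apply-term : ∀ (w : Weight k) {p u} → IsTerm p u → apply w p ≈ w u
  apply-term w {u = u} (a , refl , a≈1) =
    ≈-trans (+-identityʳ _) (≈-trans (*-congʳ a≈1) (*-identityˡ (w u)))

  apply-monomial : ∀ (w : Weight k) u → apply w (monomial u) ≈ w u
  apply-monomial w u = apply-term w (term-monomial u)

  apply-constant-* : ∀ (w : Weight k) a p → apply w (constant a P.* p) ≈ a * apply w p
  apply-constant-* w a p = ≈-trans (apply-* w (constant a) p) (≈-trans (+-identityʳ _)
    (*-congˡ (apply-cong (λ m → reflexive (cong w (⊕-identityˡ m))) p)))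

  -- The homomorphism sends monomials to monomials, so a functional is pulled back by composing its
  -- weight with the map of exponents.
  apply-evalHom : ∀ {f : Fin k → Poly l} {u} → (∀ i → IsTerm (f i) (u i)) →
                  ∀ w p → apply w (evalHom f p) ≈ apply (w ∘ combine u) p
  apply-evalHom terms w []            = ≈-refl
  apply-evalHom {f = f} terms w ((a , α) ∷ p) = begin
    apply w ((constant a P.* t^α) ++ evalHom f p)
      ≈⟨ apply-++ w (constant a P.* t^α) (evalHom f p) ⟩
    apply w (constant a P.* t^α) + apply w (evalHom f p)
      ≈⟨ +-cong (≈-trans (apply-constant-* w a t^α) (*-congˡ (apply-term w (term-product terms α))))
                (apply-evalHom terms w p) ⟩
    a * w (combine _ α) + apply (w ∘ combine _) p ∎
    where t^α = P.product (λ i → f i P.^ lookup α i)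

  binomial : Monomial k → Monomial k → Poly k
  binomial α β = monomial α P.+ (P.- monomial β)

  apply-difference : ∀ (w : Weight k) {p q u v} → IsTerm p u → IsTerm q v →
                     apply w (p P.+ (P.- q)) ≈ w u - w v
  apply-difference w {p} {q} tp tq = ≈-trans (apply-++ w p (P.- q))
    (+-cong (apply-term w tp) (≈-trans (apply-neg w q) (-‿cong (apply-term w tq))))

  apply-binomial : ∀ (w : Weight k) α β → apply w (binomial α β) ≈ w α - w β
  apply-binomial w α β = apply-difference w (term-monomial α) (term-monomial β)

  coeff-monomial : ∀ (α γ : Monomial k) → coeff (monomial α) γ ≈ point γ α
  coeff-monomial α γ = ≈-trans (coeff≈apply (monomial α) γ) (apply-monomial (point γ) α)

  coeff-binomial : ∀ (α β γ : Monomial k) → coeff (binomial α β) γ ≈ point γ α - point γ β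
  coeff-binomial α β γ = ≈-trans (coeff≈apply (binomial α β) γ) (apply-binomial (point γ) α β)

  x-0≈x : ∀ x → x - 0# ≈ x
  x-0≈x x = ≈-trans (+-congˡ -0#≈0#) (+-identityʳ x)

  point-self : ∀ (α : Monomial k) → point α α ≈ 1#
  point-self α = indicator-yes (≡-dec ℕ._≟_ α α) refl

  point-≢ : ∀ (α β : Monomial k) → β ≢ α → point α β ≈ 0#
  point-≢ α β = indicator-no (≡-dec ℕ._≟_ β α)

  module Binomials {k s} (S : Pred (Poly k) s) where
    infix 4 _≋_
    -- Congruence of monomials modulo the ideal generated by `S`.
    _≋_ : Monomial k → Monomial k → Set (c ⊔ ℓ ⊔ s)
    α ≋ β = binomial α β ∈ ⟨ S ⟩

    ≋-refl : ∀ {α} → α ≋ α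
    ≋-refl {α} = respects (apply⇒≈ P.0# (binomial α α) λ w →
      ≈-sym (≈-trans (apply-binomial w α α) (-‿inverseʳ (w α)))) zero

    ≋-sym : ∀ {α β} → α ≋ β → β ≋ α
    -- Negation is obtained from closure under multiples, with the constant -1.
    ≋-sym {α} {β} α≋β = respects (apply⇒≈ (constant (- 1#) P.* binomial α β) (binomial β α) λ w →
      begin
      apply w (constant (- 1#) P.* binomial α β)  ≈⟨ apply-constant-* w (- 1#) (binomial α β) ⟩
      - 1# * apply w (binomial α β)               ≈⟨ *-congˡ (apply-binomial w α β) ⟩
      - 1# * (w α - w β)                          ≈⟨ -1*x≈-x _ ⟩
      - (w α - w β)                               ≈⟨ -[x-y] (w α) (w β) ⟩
      w β - w α                                   ≈⟨ apply-binomial w β α ⟨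
      apply w (binomial β α)                      ∎)
      (multiple (constant (- 1#)) α≋β)
      where
      open RingProperties ring using (-1*x≈-x)
      open import Algebra.Properties.AbelianGroup +-abelianGroup using () renaming (⁻¹-anti-homo‿- to -[x-y])

    ≋-trans : ∀ {α β γ} → α ≋ β → β ≋ γ → α ≋ γ
    ≋-trans {α} {β} {γ} α≋β β≋γ = respects (apply⇒≈ (binomial α β P.+ binomial β γ) (binomial α γ) λ w →
      begin
      apply w (binomial α β P.+ binomial β γ)  ≈⟨ apply-++ w (binomial α β) (binomial β γ) ⟩
      apply w (binomial α β) + apply w (binomial β γ)
        ≈⟨ +-cong (apply-binomial w α β) (apply-binomial w β γ) ⟩
      (w α - w β) + (w β - w γ)                ≈⟨ +-assoc _ _ _ ⟩
      w α + (- w β + (w β - w γ))              ≈⟨ +-congˡ (+-assoc _ _ _) ⟨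
      w α + ((- w β + w β) - w γ)              ≈⟨ +-congˡ (+-congʳ (-‿inverseˡ (w β))) ⟩
      w α + (0# - w γ)                         ≈⟨ +-congˡ (+-identityˡ _) ⟩
      w α - w γ                                ≈⟨ apply-binomial w α γ ⟨
      apply w (binomial α γ)                   ∎)
      (sum α≋β β≋γ)

    ≋-translate : ∀ γ {α β} → α ≋ β → γ ⊕ α ≋ γ ⊕ β
    ≋-translate γ {α} {β} α≋β = respects (apply⇒≈ (monomial γ P.* binomial α β) (binomial (γ ⊕ α) (γ ⊕ β)) λ w →
      begin
      apply w (monomial γ P.* binomial α β)    ≈⟨ apply-* w (monomial γ) (binomial α β) ⟩
      apply (λ μ → apply (translate μ w) (binomial α β)) (monomial γ)
        ≈⟨ apply-monomial (λ μ → apply (translate μ w) (binomial α β)) γ ⟩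
      apply (translate γ w) (binomial α β)     ≈⟨ apply-binomial (translate γ w) α β ⟩
      w (γ ⊕ α) - w (γ ⊕ β)                    ≈⟨ apply-binomial w (γ ⊕ α) (γ ⊕ β) ⟨
      apply w (binomial (γ ⊕ α) (γ ⊕ β))       ∎)
      (multiple (monomial γ) α≋β)

-- Standard monomials

bit-isOdd+double : ∀ a → a ≡ bit (isOdd a) ℕ.+ (⌊ a /2⌋ ℕ.+ ⌊ a /2⌋)
bit-isOdd+double 0             = refl
bit-isOdd+double 1             = refl
bit-isOdd+double (suc (suc a)) = begin
  suc (suc a)                            ≡⟨ cong (λ x → suc (suc x)) (bit-isOdd+double a) ⟩
  suc (suc (b ℕ.+ (h ℕ.+ h)))            ≡⟨ cong suc (ℕ.+-suc b (h ℕ.+ h)) ⟨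
  suc (b ℕ.+ suc (h ℕ.+ h))              ≡⟨ ℕ.+-suc b (suc (h ℕ.+ h)) ⟨
  b ℕ.+ suc (suc (h ℕ.+ h))              ≡⟨ cong (λ x → b ℕ.+ suc x) (ℕ.+-suc h h) ⟨
  b ℕ.+ (suc h ℕ.+ suc h)                ∎
  where
  open ≡-Reasoning
  b = bit (isOdd a)
  h = ⌊ a /2⌋

-- Division by 2 with remainder in each exponent.
squarefree⊕square : ∀ {k} (α : Monomial k) →
  α ≡ squarefree (Vec.map isOdd α) ⊕ (Vec.map ⌊_/2⌋ α ⊕ Vec.map ⌊_/2⌋ α)
squarefree⊕square []      = refl
squarefree⊕square (a ∷ α) = cong₂ _∷_ (bit-isOdd+double a) (squarefree⊕square α)

deg≡0⇒≡𝟘 : ∀ {k} (α : Monomial k) → deg α ≡ 0 → α ≡ 𝟘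
deg≡0⇒≡𝟘 []         _  = refl
deg≡0⇒≡𝟘 (zero ∷ α) eq = cong (0 ∷_) (deg≡0⇒≡𝟘 α eq)

deg≡suc⇒lookup≡suc : ∀ {k} (α : Monomial k) {d} → deg α ≡ suc d →
                     ∃ λ i → ∃ λ r → lookup α i ≡ suc r
deg≡suc⇒lookup≡suc (suc a ∷ α) _  = zero , a , refl
deg≡suc⇒lookup≡suc (zero  ∷ α) eq with i , r , αᵢ≡ ← deg≡suc⇒lookup≡suc α eq = suc i , r , αᵢ≡

odd-⊕-square : ∀ {k} (α β : Monomial k) → Vec.map isOdd (α ⊕ (β ⊕ β)) ≡ Vec.map isOdd α
odd-⊕-square []      []      = refl
odd-⊕-square (a ∷ α) (b ∷ β) = cong₂ _∷_ (parity-cong-isOdd {a ℕ.+ (b ℕ.+ b)} {a} (begin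
  parity (a ℕ.+ (b ℕ.+ b))       ≡⟨ ℙ.+-homo-+ a (b ℕ.+ b) ⟩
  parity a ℙ.+ parity (b ℕ.+ b)    ≡⟨ cong (parity a ℙ.+_) (parity-double b) ⟩
  parity a ℙ.+ 0ℙ                  ≡⟨ ℙ.+-identityʳ (parity a) ⟩
  parity a                       ∎)) (odd-⊕-square α β)
  where open ≡-Reasoning

double-injective : ∀ {a b} → a ℕ.+ a ≡ b ℕ.+ b → a ≡ b
double-injective {a} {b} eq = trans (ℕ.n≡⌊n+n/2⌋ a)
  (trans (cong ⌊_/2⌋ eq) (sym (ℕ.n≡⌊n+n/2⌋ b)))

-- Degrees of vertices and evenness of `θ`

module VertexDegrees (G : Graph) where
  open Graph G
  open TJoins G

  edgeMonomial : Edge → Monomial n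
  edgeMonomial h = unit (left h) ⊕ unit (right h)

  -- The exponent vector of φ(t^α). Its entry at x is the degree of x in the multigraph with `α h`
  -- copies of each edge h.
  vertexDegrees : Monomial (suc m) → Monomial n
  vertexDegrees = combine edgeMonomial

  -- The ends of h are distinct because `left h` precedes `right h`, so the union in `ends` is
  -- disjoint and its bits add up.
  lookup-edgeMonomial : ∀ x h → lookup (edgeMonomial h) x ≡ bit (incident x h)
  lookup-edgeMonomial x h = begin
    lookup (edgeMonomial h) x
      ≡⟨ lookup-⊕ x (unit (left h)) (unit (right h)) ⟩
    lookup (unit (left h)) x ℕ.+ lookup (unit (right h)) x
      ≡⟨ cong₂ ℕ._+_ (lookup-unit (left h) x) (lookup-unit (right h) x) ⟩
    bit (lookup ⁅ left h ⁆ x) ℕ.+ bit (lookup ⁅ right h ⁆ x)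
      ≡⟨ bit-∨ (lookup ⁅ left h ⁆ x) (lookup ⁅ right h ⁆ x)
           (lookup-⁅⁆-disjoint (Fin.<⇒≢ (ordered h)) x) ⟨
    bit (lookup ⁅ left h ⁆ x ∨ lookup ⁅ right h ⁆ x)
      ≡⟨ cong bit (Vec.lookup-zipWith _∨_ x ⁅ left h ⁆ ⁅ right h ⁆) ⟨
    bit (lookup (ends h) x)
      ≡⟨ cong bit (does-∈? x (ends h)) ⟨
    bit (incident x h) ∎
    where open ≡-Reasoning

  θ≡odd-vertexDegrees : ∀ α → θ α ≡ Vec.map isOdd (vertexDegrees α)
  θ≡odd-vertexDegrees α = begin
    θ α
      ≡⟨ θ≡tabulate α ⟩
    tabulate (λ x → isOdd (dot α (bit ∘ incident x)))
      ≡⟨ Vec.tabulate-cong (λ x → cong isOdd (trans (lookup-combine edgeMonomial α x)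
                                             (dot-cong α (lookup-edgeMonomial x)))) ⟨
    tabulate (isOdd ∘ lookup (vertexDegrees α))
      ≡⟨ Vec.tabulate-∘ isOdd (lookup (vertexDegrees α)) ⟩
    Vec.map isOdd (tabulate (lookup (vertexDegrees α)))
      ≡⟨ cong (Vec.map isOdd) (Vec.tabulate∘lookup (vertexDegrees α)) ⟩
    Vec.map isOdd (vertexDegrees α) ∎
    where open ≡-Reasoning

  -- Double counting of incidences. The constant 1 gives the handshake lemma, the indicator of a
  -- component gives `θ-even`.
  dot-vertexDegrees : ∀ α g → dot (vertexDegrees α) g ≡ dot α (λ h → g (left h) ℕ.+ g (right h))
  dot-vertexDegrees α g = trans
    (additive-combine (λ u → dot u g) (dot-𝟘 g) (λ u v → dot-⊕ u v g) edgeMonomial α)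
    (dot-cong α λ h → trans (dot-⊕ (unit (left h)) (unit (right h)) g)
      (cong₂ ℕ._+_ (trans (dot-power (left h) 1 g) (ℕ.*-identityˡ _))
                   (trans (dot-power (right h) 1 g) (ℕ.*-identityˡ _))))

  deg-vertexDegrees : ∀ α → deg (vertexDegrees α) ≡ deg α ℕ.* 2
  deg-vertexDegrees α = trans (deg≡dot (vertexDegrees α))
    (trans (dot-vertexDegrees α (λ _ → 1)) (dot-constant α 2))

  dot-even : ∀ {k} (α : Monomial k) {f} → (∀ i → parity (f i) ≡ 0ℙ) → parity (dot α f) ≡ 0ℙ
  dot-even []          even = refl
  dot-even (a ∷ α) {f} even = begin
    parity (a ℕ.* f zero ℕ.+ dot α (f ∘ suc))       ≡⟨ ℙ.+-homo-+ (a ℕ.* f zero) _ ⟩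
    parity (a ℕ.* f zero) ℙ.+ parity (dot α (f ∘ suc)) ≡⟨ cong₂ ℙ._+_ head-even (dot-even α (even ∘ suc)) ⟩
    0ℙ                                              ∎
    where
    open ≡-Reasoning
    head-even : parity (a ℕ.* f zero) ≡ 0ℙ
    head-even = trans (ℙ.*-homo-* a (f zero))
      (trans (cong (parity a ℙ.*_) (even zero)) (ℙ.*-zeroʳ (parity a)))

  component-left≡right : ∀ {C} → IsComponent C → ∀ h → lookup C (left h) ≡ lookup C (right h)
  component-left≡right {C} (u , C⇔) h with lookup C (left h) in l≡ | lookup C (right h) in r≡
  ... | true  | true  = refl
  ... | false | false = refl
  ... | true  | false = trans (sym (Vec.[]=⇒lookup (Equivalence.from (C⇔ (right h))
      (Equivalence.to (C⇔ (left h)) (Vec.lookup⇒[]= (left h) C l≡) ◅◅ (h , refl) ◅ Star.ε)))) r≡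
  ... | false | true  = trans (sym l≡) (Vec.[]=⇒lookup (Equivalence.from (C⇔ (left h))
      (Equivalence.to (C⇔ (right h)) (Vec.lookup⇒[]= (right h) C r≡)
        ◅◅ (h , ∪-comm ⁅ left h ⁆ ⁅ right h ⁆) ◅ Star.ε)))

  -- An edge has both ends in a component or neither, so it adds 2 or 0 to the sum of the degrees
  -- over that component.
  θ-even : ∀ α → EvenSubset (θ α)
  θ-even α C component = begin
    parity ∣ θ α ∩ C ∣
      ≡⟨ cong₂ (λ S T → parity ∣ S ∩ T ∣) (θ≡odd-vertexDegrees α) (sym (Vec.tabulate∘lookup C)) ⟩
    parity ∣ Vec.map isOdd (vertexDegrees α) ∩ tabulate (lookup C) ∣
      ≡⟨ parity-odd-∩ (vertexDegrees α) (lookup C) ⟩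
    parity (dot (vertexDegrees α) (bit ∘ lookup C))
      ≡⟨ cong parity (dot-vertexDegrees α (bit ∘ lookup C)) ⟩
    parity (dot α (λ h → bit (lookup C (left h)) ℕ.+ bit (lookup C (right h))))
      ≡⟨ dot-even α (λ h → trans
           (cong (λ b → parity (bit b ℕ.+ bit (lookup C (right h)))) (component-left≡right component h))
           (parity-double (bit (lookup C (right h))))) ⟩
    0ℙ ∎
    where open ≡-Reasoning

-- Binomials in the Eulerian ideal

module StandardMonomials {c ℓ} (K : Field c ℓ) (G : Graph) where
  open Graph G
  open TJoins G
  open VertexDegrees G
  open Eulerian K G
  open Field K hiding (zero; _≉_)
    renaming (refl to ≈-refl; sym to ≈-sym; trans to ≈-trans)
  open Functionals commutativeRing
  module P {k : ℕ} = RawRing (polyRing k)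
  module Squares = Binomials squareDifferences

  square-term : ∀ i → IsTerm (var {n} i P.* var i) (unit i ⊕ unit i)
  square-term i = term-* (term-monomial (unit i)) (term-monomial (unit i))

  square≋square : ∀ i j → unit i ⊕ unit i Squares.≋ unit j ⊕ unit j
  square≋square i j = respects (apply⇒≈ ((var i P.* var i) P.+ (P.- (var j P.* var j)))
             (binomial (unit i ⊕ unit i) (unit j ⊕ unit j)) λ w → ≈-trans
      (apply-difference w (square-term i) (square-term j))
      (≈-sym (apply-binomial w (unit i ⊕ unit i) (unit j ⊕ unit j))))
    (generator (i , j , refl))
  -- The factors x_i² of the square of x^u are exchanged for x_z² one at a time.
  square≋power : ∀ z d u → deg u ≡ d → u ⊕ u Squares.≋ (d • unit z) ⊕ (d • unit z)
  square≋power z zero    u deg≡ =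
    subst (λ v → v ⊕ v Squares.≋ 𝟘 ⊕ 𝟘) (sym (deg≡0⇒≡𝟘 u deg≡)) (Squares.≋-refl {𝟘 ⊕ 𝟘})
  square≋power z (suc d) u deg≡
    with i , r , uᵢ≡ ← deg≡suc⇒lookup≡suc u deg≡
    with v , refl ← divide-power i u uᵢ≡ =
      subst₂ Squares._≋_ (sym (⊕-interchange (unit i) v (unit i) v))
        (sym (⊕-interchange (unit z) dz (unit z) dz))
        (Squares.≋-trans {(unit i ⊕ unit i) ⊕ (v ⊕ v)} {(unit i ⊕ unit i) ⊕ (dz ⊕ dz)}
          {(unit z ⊕ unit z) ⊕ (dz ⊕ dz)}
          (Squares.≋-translate (unit i ⊕ unit i) {v ⊕ v} {dz ⊕ dz} (square≋power z d v deg-v))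
          (subst₂ Squares._≋_ (⊕-comm (dz ⊕ dz) (unit i ⊕ unit i)) (⊕-comm (dz ⊕ dz) (unit z ⊕ unit z))
            (Squares.≋-translate (dz ⊕ dz) {unit i ⊕ unit i} {unit z ⊕ unit z} (square≋square i z))))
    where
    dz = d • unit z
    deg-v : deg v ≡ d
    deg-v = ℕ.suc-injective (trans (sym (trans (deg-⊕ (unit i) v) (cong (ℕ._+ deg v) (deg-power i 1)))) deg≡)

  -- The common odd part splits off. The remaining squares have the same degree, and both are
  -- congruent to the same power of x_z.
  ≋-vertex : ∀ u v → deg u ≡ deg v → Vec.map isOdd u ≡ Vec.map isOdd v → u Squares.≋ v
  ≋-vertex u v deg≡ odd≡ =
    subst₂ Squares._≋_ (sym (squarefree⊕square u))
      (sym (trans (squarefree⊕square v) (cong (λ o → squarefree o ⊕ (hv ⊕ hv)) (sym odd≡))))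
      (Squares.≋-translate (squarefree (Vec.map isOdd u)) {hu ⊕ hu} {hv ⊕ hv}
        (Squares.≋-trans {hu ⊕ hu} {zs ⊕ zs} {hv ⊕ hv} (square≋power z (deg hu) hu refl)
          (Squares.≋-sym {hv ⊕ hv} {zs ⊕ zs} (square≋power z (deg hu) hv (sym deg-h≡)))))
    where
    -- Any vertex would do; an end of the first edge is always at hand.
    z  = left zero
    hu = Vec.map ⌊_/2⌋ u
    hv = Vec.map ⌊_/2⌋ v
    zs = deg hu • unit z
    deg-split : ∀ w → deg w ≡ deg (squarefree (Vec.map isOdd w)) ℕ.+
                              (deg (Vec.map ⌊_/2⌋ w) ℕ.+ deg (Vec.map ⌊_/2⌋ w))
    deg-split w = trans (cong deg (squarefree⊕square w))
      (trans (deg-⊕ (squarefree (Vec.map isOdd w)) (h ⊕ h))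
             (cong (deg (squarefree (Vec.map isOdd w)) ℕ.+_) (deg-⊕ h h)))
      where h = Vec.map ⌊_/2⌋ w
    deg-h≡ : deg hu ≡ deg hv
    deg-h≡ = double-injective (ℕ.+-cancelˡ-≡ (deg (squarefree (Vec.map isOdd u))) _ _
      (trans (sym (deg-split u)) (trans deg≡ (trans (deg-split v)
        (cong (λ o → deg (squarefree o) ℕ.+ (deg hv ℕ.+ deg hv)) (sym odd≡))))))

  φ-term : ∀ h → IsTerm (var (left h) P.* var (right h)) (edgeMonomial h)
  φ-term h = term-* (term-monomial (unit (left h))) (term-monomial (unit (right h)))

  apply-φ : ∀ w p → apply w (φ p) ≈ apply (w ∘ vertexDegrees) p
  apply-φ = apply-evalHom φ-term

  -- `vertexDegrees` doubles the degree and has `θ` as its odd part, so the images of equivalent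
  -- monomials satisfy the hypotheses of `≋-vertex`.
  ∼⇒binomial∈eulerianIdeal : ∀ α β → α ∼ β → binomial α β ∈ eulerianIdeal
  ∼⇒binomial∈eulerianIdeal α β (deg≡ , θ≡) = respects
    (apply⇒≈ (binomial (vertexDegrees α) (vertexDegrees β)) (φ (binomial α β)) λ w → begin
      apply w (binomial (vertexDegrees α) (vertexDegrees β))
        ≈⟨ apply-binomial w (vertexDegrees α) (vertexDegrees β) ⟩
      w (vertexDegrees α) - w (vertexDegrees β)
        ≈⟨ apply-binomial (w ∘ vertexDegrees) α β ⟨
      apply (w ∘ vertexDegrees) (binomial α β)
        ≈⟨ apply-φ w (binomial α β) ⟨
      apply w (φ (binomial α β)) ∎)
    (≋-vertex (vertexDegrees α) (vertexDegrees β)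
      (trans (deg-vertexDegrees α) (trans (cong (ℕ._* 2) deg≡) (sym (deg-vertexDegrees β))))
      (trans (sym (θ≡odd-vertexDegrees α)) (trans θ≡ (θ≡odd-vertexDegrees β))))
    where open SetoidReasoning setoid

  -- Standard monomials of (I(X_G), tₑ)

  Least : Permutation′ (suc m) → Monomial (suc m) → Set
  Least ε α = ∀ β → β ∼ α → α ≡ β ⊎ Grevlex ε α β

  module _ (e : Edge) (ε : Permutation′ (suc m)) where
    open GrevlexProperties ε
    open SetoidReasoning setoid

    ≺⇒≢ : ∀ α β → α ≺ β → α ≢ β
    ≺⇒≢ α .α α≺α refl = ≺-irrefl {α} α≺α

    nonstandard : ∀ {f α} → f ∈ eulerianIdealWith e → IsLeadingMonomial _≺_ f α → ¬ α ∈ 𝓑 e ε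
    nonstandard {f} {α} f∈ leading standard = standard (generator (f , α , f∈ , leading , refl))

    -- A member t^β = tₑ t^γ of the class puts t^α = (t^α - t^β) + t^γ tₑ into the ideal, and t^α is
    -- its own leading monomial.
    standard⇒avoids : ∀ {α} → α ∈ 𝓑 e ε → Avoids e α
    standard⇒avoids {α} standard β (deg≡ , θ≡) with lookup β e in lookup≡
    ... | zero  = refl
    ... | suc _ with γ , refl ← divide-power e β lookup≡ = contradiction standard
      (nonstandard {monomial α} {α} monomial∈ (leading , λ γ α≺γ →
        ≈-trans (coeff-monomial α γ) (point-≢ γ α (≺⇒≢ α γ α≺γ))))
      where
      leading : ¬ coeff (monomial α) α ≈ 0#
      leading coeff≈0 = 1≉0 (≈-trans (≈-sym (≈-trans (coeff-monomial α α) (point-self α))) coeff≈0)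
      combination = binomial α β P.+ (monomial γ P.* var e)
      monomial∈ : monomial α ∈ eulerianIdealWith e
      monomial∈ = respects (apply⇒≈ combination (monomial α) λ w → begin
          apply w combination
            ≈⟨ apply-++ w (binomial α β) (monomial γ P.* var e) ⟩
          apply w (binomial α β) + apply w (monomial γ P.* var e)
            ≈⟨ +-cong (apply-binomial w α β)
                      (apply-term w (term-* (term-monomial γ) (term-monomial (unit e)))) ⟩
          (w α - w β) + w (γ ⊕ unit e)
            ≈⟨ +-congˡ (reflexive (cong w (⊕-comm γ (unit e)))) ⟩
          (w α - w β) + w β
            ≈⟨ +-assoc _ _ _ ⟩
          w α + (- (w β) + w β)
            ≈⟨ ≈-trans (+-congˡ (-‿inverseˡ (w β))) (+-identityʳ (w α)) ⟩
          w α
            ≈⟨ apply-monomial w α ⟨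
          apply w (monomial α) ∎)
        (sum (generator {f = binomial α β} (inj₁ (∼⇒binomial∈eulerianIdeal α β (sym deg≡ , sym θ≡))))
             (multiple (monomial γ) (generator (inj₂ refl))))

    -- For β ≺ α the element t^α - t^β of the ideal would have leading monomial t^α.
    standard⇒least : ∀ {α} → α ∈ 𝓑 e ε → Least ε α
    standard⇒least {α} standard β (deg≡ , θ≡) with ≺-total α β
    ... | inj₁ α≺β        = inj₂ α≺β
    ... | inj₂ (inj₁ α≡β) = inj₁ α≡β
    ... | inj₂ (inj₂ β≺α) = contradiction standard (nonstandard {binomial α β} {α}
      (generator (inj₁ (∼⇒binomial∈eulerianIdeal α β (sym deg≡ , sym θ≡)))) (leading , above))
      where
      leading : ¬ coeff (binomial α β) α ≈ 0#
      leading coeff≈0 = 1≉0 (begin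
        1#                          ≈⟨ x-0≈x 1# ⟨
        1# - 0#                     ≈⟨ +-cong (point-self α) (-‿cong (point-≢ α β (≺⇒≢ β α β≺α))) ⟨
        point α α - point α β       ≈⟨ coeff-binomial α β α ⟨
        coeff (binomial α β) α      ≈⟨ coeff≈0 ⟩
        0#                          ∎)
      above : ∀ γ → α ≺ γ → coeff (binomial α β) γ ≈ 0#
      above γ α≺γ = ≈-trans (coeff-binomial α β γ) (≈-trans
        (+-cong (point-≢ γ α (≺⇒≢ α γ α≺γ))
                (-‿cong (point-≢ γ β (≺⇒≢ β γ (≺-trans {β} {α} {γ} β≺α α≺γ)))))
        (x-0≈x 0#))

    module _ (α : Monomial (suc m)) where

      -- The class of t^α as seen in K[V_G]; the factor 2 appears because each `φ` (t_h) is
      -- quadratic.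
      inClass? : ∀ u → Dec (deg u ≡ deg α ℕ.* 2 × Vec.map isOdd u ≡ θ α)
      inClass? u = (deg u ℕ.≟ deg α ℕ.* 2) ×-dec (≡-dec Bool._≟_ (Vec.map isOdd u) (θ α))

      classWeight : Weight n
      classWeight u = indicator (inClass? u)

      inClass⇒∼ : ∀ β → deg (vertexDegrees β) ≡ deg α ℕ.* 2 ×
                          Vec.map isOdd (vertexDegrees β) ≡ θ α → β ∼ α
      inClass⇒∼ β (deg≡ , odd≡) =
        ℕ.*-cancelʳ-≡ (deg β) (deg α) 2 (trans (sym (deg-vertexDegrees β)) deg≡) ,
        trans (θ≡odd-vertexDegrees β) odd≡

      -- Multiplying by x_i² or by x_j² raises the degree by 2 and keeps the odd part, so both
      -- products get the same weight.
      classWeight-kills-squareDifferences : ∀ μ {g} → g ∈ squareDifferences →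
                                            apply (translate μ classWeight) g ≈ 0#
      classWeight-kills-squareDifferences μ (i , j , refl) = begin
        apply (translate μ classWeight) ((var i P.* var i) P.+ (P.- (var j P.* var j)))
          ≈⟨ apply-difference (translate μ classWeight) (square-term i) (square-term j) ⟩
        classWeight (μ ⊕ (unit i ⊕ unit i)) - classWeight (μ ⊕ (unit j ⊕ unit j))
          ≡⟨ cong (_- classWeight (μ ⊕ (unit j ⊕ unit j)))
               (cong₂ (λ d T → indicator ((d ℕ.≟ deg α ℕ.* 2) ×-dec (≡-dec Bool._≟_ T (θ α))))
                 (trans (deg≡ i) (sym (deg≡ j))) (trans (odd≡ i) (sym (odd≡ j)))) ⟩
        classWeight (μ ⊕ (unit j ⊕ unit j)) - classWeight (μ ⊕ (unit j ⊕ unit j))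
          ≈⟨ -‿inverseʳ _ ⟩
        0# ∎
        where
        deg≡ : ∀ i → deg (μ ⊕ (unit i ⊕ unit i)) ≡ deg μ ℕ.+ 2
        deg≡ i = trans (deg-⊕ μ (unit i ⊕ unit i)) (cong (deg μ ℕ.+_)
          (trans (deg-⊕ (unit i) (unit i)) (cong₂ ℕ._+_ (deg-power i 1) (deg-power i 1))))
        odd≡ : ∀ i → Vec.map isOdd (μ ⊕ (unit i ⊕ unit i)) ≡ Vec.map isOdd μ
        odd≡ i = odd-⊕-square μ (unit i)

      -- On I(X_G), translating by μ amounts to translating by `vertexDegrees μ` after `φ`. For tₑ,
      -- avoidance says that no multiple of it lies in the class, so all of them get weight 0.
      classWeight-kills-generators : Avoids e α → ∀ μ {g} → g ∈ eulerianIdeal ∪ ｛ var e ｝ →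
                                     apply (translate μ (classWeight ∘ vertexDegrees)) g ≈ 0#
      classWeight-kills-generators _ μ {g} (inj₁ g∈I) = begin
        apply (translate μ (classWeight ∘ vertexDegrees)) g
          ≈⟨ apply-cong (λ γ → reflexive (cong classWeight (combine-⊕ edgeMonomial μ γ))) g ⟩
        apply (translate (vertexDegrees μ) classWeight ∘ vertexDegrees) g
          ≈⟨ apply-φ (translate (vertexDegrees μ) classWeight) g ⟨
        apply (translate (vertexDegrees μ) classWeight) (φ g)
          ≈⟨ apply-translate-⟨⟩ classWeight classWeight-kills-squareDifferences g∈I (vertexDegrees μ) ⟩
        0# ∎
      classWeight-kills-generators avoids μ (inj₂ refl) = ≈-trans
        (apply-monomial (translate μ (classWeight ∘ vertexDegrees)) (unit e))
        (indicator-no (inClass? (vertexDegrees (μ ⊕ unit e))) λ inClass →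
          contradiction (trans (sym lookup≡) (avoids (μ ⊕ unit e) (inClass⇒∼ (μ ⊕ unit e) inClass))) λ ())
        where
        lookup≡ : lookup (μ ⊕ unit e) e ≡ suc (lookup μ e)
        lookup≡ = trans (lookup-⊕ e μ (unit e)) (trans (cong (lookup μ e ℕ.+_)
          (Vec.lookup∘update e 𝟘 1)) (ℕ.+-comm (lookup μ e) 1))

      -- The sum of the coefficients of f over the class of α is zero, and all
      -- of them but that of t^α vanish because α is least in its class.
      least⇒not-leading : Avoids e α → Least ε α → ∀ {f} → f ∈ eulerianIdealWith e →
                          ¬ IsLeadingMonomial _≺_ f α
      least⇒not-leading avoids isLeast {f} f∈ (leading , above) = leading (begin
        coeff f α                               ≈⟨ ≈-trans (*-congʳ w-α) (*-identityˡ _) ⟨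
        w α * coeff f α                         ≈⟨ +-identityˡ _ ⟨
        0# + w α * coeff f α                    ≈⟨ +-congʳ (apply-vanishes (erase α w) f vanish) ⟨
        apply (erase α w) f + w α * coeff f α   ≈⟨ apply-erase α w f ⟨
        apply w f                               ≈⟨ apply-⟨⟩ w (classWeight-kills-generators avoids) f∈ ⟩
        0#                                      ∎)
        where
        w : Weight (suc m)
        w = classWeight ∘ vertexDegrees
        w-α : w α ≈ 1#
        w-α = indicator-yes (inClass? (vertexDegrees α))
          (deg-vertexDegrees α , sym (θ≡odd-vertexDegrees α))
        off-α : ∀ γ → γ ≢ α → w γ * coeff f γ ≈ 0#
        off-α γ γ≢α with inClass? (vertexDegrees γ)
        ... | no ¬inClass = ≈-trans (*-congʳ (indicator-no (inClass? (vertexDegrees γ)) ¬inClass)) (zeroˡ _)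
        ... | yes inClass with isLeast γ (inClass⇒∼ γ inClass)
        ...   | inj₁ α≡γ = contradiction (sym α≡γ) γ≢α
        ...   | inj₂ α≺γ = ≈-trans (*-congˡ (above γ α≺γ)) (zeroʳ _)
        vanish : ∀ γ → erase α w γ * coeff f γ ≈ 0#
        vanish γ with ≡-dec ℕ._≟_ γ α
        ... | yes _   = zeroˡ _
        ... | no  γ≢α = off-α γ γ≢α

    -- The initial ideal is generated by monomials, so the coefficient at α vanishes on it once no
    -- leading monomial t^β divides t^α. If t^α = t^μ t^β, then t^μ carries the class of t^β into
    -- that of t^α; hence t^β too is least in a class avoiding tₑ and cannot lead.
    least⇒standard : ∀ {α} → Avoids e α → Least ε α → α ∈ 𝓑 e ε
    least⇒standard {α} avoids isLeast monomial∈ = 1≉0 (begin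
      1#                            ≈⟨ point-self α ⟨
      point α α                     ≈⟨ apply-monomial (point α) α ⟨
      apply (point α) (monomial α)  ≈⟨ apply-⟨⟩ (point α) kills monomial∈ ⟩
      0#                            ∎)
      where
      kills : ∀ μ {g} → (∃ λ f → ∃ λ β → f ∈ eulerianIdealWith e ×
                        IsLeadingMonomial _≺_ f β × g ≡ monomial β) →
              apply (translate μ (point α)) g ≈ 0#
      kills μ (f , β , f∈ , leading , refl) = ≈-trans (apply-monomial (translate μ (point α)) β)
        (point-≢ α (μ ⊕ β) λ eq → least⇒not-leading β (avoids-β eq) (least-β eq) {f} f∈ leading)
        where
        avoids-β : μ ⊕ β ≡ α → Avoids e β
        avoids-β refl γ γ∼β = ℕ.m+n≡0⇒n≡0 (lookup μ e)
          (trans (sym (lookup-⊕ e μ γ)) (avoids (μ ⊕ γ) (∼-translate μ γ∼β)))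
        least-β : μ ⊕ β ≡ α → Least ε β
        least-β refl γ γ∼β = Sum.map (⊕-cancelˡ μ) (≺-cancelˡ μ) (isLeast (μ ⊕ γ) (∼-translate μ γ∼β))

open import Data.Parity.Base using (_+_)

theorem4p9 : ∀ {c ℓ} (K : Field c ℓ) (G : Graph) → let open Graph G in let open Eulerian K G in
    NoIsolatedVertices →
    (e : Edge) (ε : Permutation′ (suc m)) → ε ⟨$⟩ʳ fromℕ m ≡ e →
    (∀ {α β} → α ∈ 𝓑 e ε → β ∈ 𝓑 e ε → ϑ α ≡ ϑ β → α ≡ β) ×
    (∀ (T : Subset n) (i : Parity) →
    (∃ λ α → α ∈ 𝓑 e ε × ϑ α ≡ (T , i)) ⇔
    (EvenSubset T ×
    (∃ λ J → J ∈ Joins i T) ×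
    (∃ λ k → τ[ i , T ]≡ k × τ[ i + 1ℙ , T △ ends e ]≡ suc k)))
theorem4p9 K G _ e ε _ = injective , λ T i → mk⇔ to from
  where
  open Graph G
  open TJoins G
  open VertexDegrees G
  open Eulerian K G
  open StandardMonomials K G
  open GrevlexProperties ε

  -- `ϑ` keeps the degree only modulo 2. Each of the two degrees is minimal for the common `θ` and
  -- parity, so they agree; then α and β lie in one class, where the least monomial is unique.
  injective : ∀ {α β} → α ∈ 𝓑 e ε → β ∈ 𝓑 e ε → ϑ α ≡ ϑ β → α ≡ β
  injective {α} {β} α∈ β∈ ϑ≡
    with standard⇒least e ε α∈ β (sym deg≡ , sym (cong proj₁ ϑ≡))
       | standard⇒least e ε β∈ α (deg≡ , cong proj₁ ϑ≡)
    where
    deg≡ : deg α ≡ deg β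
    deg≡ = ℕ.≤-antisym
      (avoids⇒deg≤ {e} {α} (standard⇒avoids e ε α∈) β (sym (cong proj₁ ϑ≡)) (sym (cong proj₂ ϑ≡)))
      (avoids⇒deg≤ {e} {β} (standard⇒avoids e ε β∈) α (cong proj₁ ϑ≡) (cong proj₂ ϑ≡))
  ... | inj₁ α≡β | _        = α≡β
  ... | inj₂ _   | inj₁ β≡α = sym β≡α
  ... | inj₂ α≺β | inj₂ β≺α = contradiction (≺-trans {α} {β} {α} α≺β β≺α) (≺-irrefl {α})

  to : ∀ {T i} → (∃ λ α → α ∈ 𝓑 e ε × ϑ α ≡ (T , i)) →
       EvenSubset T × (∃ λ J → J ∈ Joins i T) ×
       (∃ λ k → τ[ i , T ]≡ k × τ[ i + 1ℙ , T △ ends e ]≡ suc k)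
  to (α , α∈ , refl) = θ-even α , (oddPart α , refl , parity-∣odd∣ α) ,
    deg α , avoids⇒τ {e} {α} avoids , avoids⇒τ-△ {e} {α} avoids
    where avoids = standard⇒avoids e ε α∈

  -- For a minimum join J the class of t^J avoids tₑ, but t^J need not be least in it. The preimage
  -- is the least monomial of that class, which is finite because its degree is fixed.
  from : ∀ {T i} → EvenSubset T × (∃ λ J → J ∈ Joins i T) ×
         (∃ λ k → τ[ i , T ]≡ k × τ[ i + 1ℙ , T △ ends e ]≡ suc k) →
         ∃ λ α → α ∈ 𝓑 e ε × ϑ α ≡ (T , i)
  from (_ , _ , _ , ((J , (refl , refl) , refl) , _) , τ-△)
    with α , (deg≡ , θ≡) , α≼ ← least
           (λ α → (deg α ℕ.≟ deg (squarefree J)) ×-dec ≡-dec Bool._≟_ (θ α) (θ (squarefree J)))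
           (deg (squarefree J)) (λ α∼J → ℕ.≤-reflexive (proj₁ α∼J))
           (squarefree J , refl , refl) =
    α , least⇒standard e ε avoids isLeast , cong₂ _,_ θ-α (cong parity deg-α)
    where
    deg-α : deg α ≡ ∣ J ∣
    deg-α = trans deg≡ (deg-squarefree J)
    θ-α : θ α ≡ oddVertices J
    θ-α = trans θ≡ (θ-squarefree J)
    avoids : Avoids e α
    avoids = τ-△⇒avoids {e} {α} (subst₂ (λ k T → τ[ parity k + 1ℙ , T △ ends e ]≡ suc k)
      (sym deg-α) (sym θ-α) τ-△)
    isLeast : Least ε α
    isLeast β (deg-β , θ-β) = α≼ β (trans deg-β deg≡ , trans θ-β θ≡)
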